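{- Let the matching graph be complete, i.e. $\mathcal E=\mathcal D\times\mathcal S$, with any numbers $n_{\mathcal D}\ge 1$ and $n_{\mathcal S}\ge 1$ of demand and supply nodes. Then for every $\theta\in[0,1)$ the optimal control for the discounted cost problem is to match everything: the stationary policy $\pi$ using the decision rule $u_x$ with $x-u_x=0$ for every $x\in\mathcal Q$ satisfies $v_\theta^{\pi}(y)=v_\theta^\ast(y)$ for all $y\in\mathcal Y$.
   Context: Matching model. $(\mathcal D\cup\mathcal S,\mathcal E)$ is a finite bipartite graph with demand nodes $\mathcal D=\{d_1,\dots,d_{n_{\mathcal D}}\}$, supply nodes $\mathcal S=\{s_1,\dots,s_{n_{\mathcal S}}\}$ and allowed matching pairs $\mathcal E\subset\mathcal D\times\mathcal S$. A pair $(i,j)$ stands for $(d_i,s_j)$, and indices are identified with nodes. $\mathcal S(i)=\{j:(i,j)\in\mathcal E\}$, $\mathcal D(j)=\{i:(i,j)\in\mathcal E\}$, and $\mathcal S(D)=\bigcup_{i\in D}\mathcal S(i)$, $\mathcal D(S)=\bigcup_{j\in S}\mathcal D(j)$. For a node $k$, $e_k\in\mathbb N^{n_{\mathcal D}+n_{\mathcal S}}$ is the unit vector ($\mathbb N=\{0,1,\dots\}$), and $e_{(i,j)}=e_{d_i}+e_{s_j}$. $\mathcal A=\mathcal D\times\mathcal S$ is the set of arrival pairs, $(i,j)\in\mathcal A$ being identified with $e_{(i,j)}$. At each time an arrival, independent and distributed as a random variable $A$, occurs: $\mathbb P(A=e_{(i,j)})=\alpha_i\beta_j>0$, $\sum_i\alpha_i=\sum_j\beta_j=1$.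 Stability condition: for all nonempty $D\subsetneq\mathcal D$ and nonempty $S\subsetneq\mathcal S$, $\sum_{i\in D}\alpha_i<\sum_{j\in\mathcal S(D)}\beta_j$ and $\sum_{j\in S}\beta_j<\sum_{i\in\mathcal D(S)}\alpha_i$. States: $\mathcal Q=\{q\in\mathbb N^{n_{\mathcal D}+n_{\mathcal S}}:\sum_{k\in\mathcal D}q_k=\sum_{k\in\mathcal S}q_k\}$, $\mathcal Y=\mathcal Q\times\mathcal A$. For $x\in\mathcal Q$, the set of admissible matchings $U_x$ is the set of $u=\sum_{(i,j)\in\mathcal E}u_{(i,j)}e_{(i,j)}$ with $u_{(i,j)}\in\mathbb N$ (the number of matchings in edge $(i,j)$), $\sum_{k\in\mathcal S(i)}u_{(i,k)}\le x_{d_i}$ for all $i$ and $\sum_{k\in\mathcal D(j)}u_{(k,j)}\le x_{s_j}$ for all $j$. Dynamics and costs: a decision rule maps each $x\in\mathcal Q$ to some $u_x\in U_x$. A policy $\pi$ is a sequence of decision rules; it is stationary if the same rule is used at all times. The process is $Y(n)=(Q(n),A(n))$, with $X(n)=Q(n)+A(n)$ and $Q(n+1)=X(n)-u$, where $u\in U_{X(n)}$ is the matching chosen by the rule used at time $n$ in $X(n)$; $Y(0)=y$. The cost in state $y=(q,a)$ is $c(y)=c(x)=\sum_{k\in\mathcal D\cup\mathcal S}c_kx_k$ with $x=q+a$, a linear function assumed nonnegative on $\mathcal Q$ and nondecreasing in the sense $c(x+e_{(i,j)})\ge c(x)$ for all $(i,j)\in\mathcal E$. Discounted cost: $v_\theta^\pi(y)=\lim_{N\to\infty}\sum_{n=0}^{N-1}\theta^n\mathbb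 E_y^\pi[c(Y(n))]$ and $v_\theta^\ast(y)=\inf_\pi v_\theta^\pi(y)$, the infimum being over all policies. -}

module Defs where

open import Level using (0ℓ)
open import Algebra.Bundles using (RawMonoid; RawSemiring)
import Algebra.Definitions.RawMonoid as RawMonoidDefs
import Algebra.Definitions.RawSemiring as RawSemiringDefs
import Algebra.Properties.CommutativeMonoid.Sum as CommutativeMonoidSum
open import Data.Bool using (Bool; true; false; if_then_else_)
open import Data.Fin using (Fin; zero; suc; toℕ; _↑ˡ_; _↑ʳ_; splitAt)
import Data.Fin as Fin
import Data.Fin.Properties as Fin
open import Data.Fin.Subset using (Subset; Nonempty; ⊤; ⋃; _⊂_)
open import Data.Fin.Subset.Properties using (_∈?_)
import Data.List as List
open import Data.Nat using (ℕ; zero; suc; _∸_)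
import Data.Nat as ℕ
import Data.Nat.Properties as ℕ
open import Data.Product using (Σ; ∃; ∃-syntax; _×_; _,_; proj₁; proj₂)
open import Data.Rational using (ℚ; 0ℚ; 1ℚ; ½)
import Data.Rational as ℚ
import Data.Rational.Properties as ℚ
open import Data.Rational.Solver using (module +-*-Solver)
open import Data.Sum using (_⊎_; inj₁; inj₂)
open import Data.Vec using (Vec; []; _∷_; lookup; replicate; tabulate; zipWith; _[_]≔_)
import Data.Vec.Properties as Vec
open import Function using (_∘_)
open import Relation.Binary.Core using (REL)
open import Relation.Binary.Definitions using (Decidable; Universal)
open import Relation.Binary.PropositionalEquality
  using (_≡_; _≢_; refl; sym; trans; cong; cong₂; subst; module ≡-Reasoning)
open import Relation.Nullary using (does; yes; no; contradiction)

half>0 : ∀ {ε} → 0ℚ ℚ.< ε → 0ℚ ℚ.< ½ ℚ.* ε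
half>0 {ε} ε>0 = ℚ.positive⁻¹ (½ ℚ.* ε) {{ℚ.pos*pos⇒pos ½ ε {{ℚ.positive ε>0}}}}

half+half : ∀ ε → ½ ℚ.* ε ℚ.+ ½ ℚ.* ε ≡ ε
half+half ε = trans (sym (ℚ.*-distribʳ-+ ε ½ ½)) (ℚ.*-identityˡ ε)

∣p∣-∣q∣≤∣p-q∣ : ∀ p q → ℚ.∣ p ∣ ℚ.- ℚ.∣ q ∣ ℚ.≤ ℚ.∣ p ℚ.- q ∣
∣p∣-∣q∣≤∣p-q∣ p q = begin
  ℚ.∣ p ∣ ℚ.- ℚ.∣ q ∣                        ≡⟨ cong (λ r → ℚ.∣ r ∣ ℚ.- ℚ.∣ q ∣) (lem p q) ⟩
  ℚ.∣ (p ℚ.- q) ℚ.+ q ∣ ℚ.- ℚ.∣ q ∣          ≤⟨ ℚ.+-monoˡ-≤ (ℚ.- ℚ.∣ q ∣) (ℚ.∣p+q∣≤∣p∣+∣q∣ (p ℚ.- q) q) ⟩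
  ℚ.∣ p ℚ.- q ∣ ℚ.+ ℚ.∣ q ∣ ℚ.- ℚ.∣ q ∣      ≡⟨ lem′ ℚ.∣ p ℚ.- q ∣ ℚ.∣ q ∣ ⟩
  ℚ.∣ p ℚ.- q ∣                              ∎
  where
  open ℚ.≤-Reasoning
  open +-*-Solver
  lem : ∀ p q → p ≡ (p ℚ.- q) ℚ.+ q
  lem = solve 2 (λ p q → p := (p :- q) :+ q) refl
  lem′ : ∀ a b → a ℚ.+ b ℚ.- b ≡ a
  lem′ = solve 2 (λ a b → a :+ b :- b := a) refl

∣p-q∣≡∣q-p∣ : ∀ p q → ℚ.∣ p ℚ.- q ∣ ≡ ℚ.∣ q ℚ.- p ∣
∣p-q∣≡∣q-p∣ p q = trans (cong ℚ.∣_∣ (lem p q)) (ℚ.∣-p∣≡∣p∣ (q ℚ.- p))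
  where
  open +-*-Solver
  lem : ∀ p q → p ℚ.- q ≡ ℚ.- (q ℚ.- p)
  lem = solve 2 (λ p q → p :- q := :- (q :- p)) refl

∣∣p∣-∣q∣∣≤∣p-q∣ : ∀ p q → ℚ.∣ ℚ.∣ p ∣ ℚ.- ℚ.∣ q ∣ ∣ ℚ.≤ ℚ.∣ p ℚ.- q ∣
∣∣p∣-∣q∣∣≤∣p-q∣ p q with ℚ.∣p∣≡p∨∣p∣≡-p (ℚ.∣ p ∣ ℚ.- ℚ.∣ q ∣)
... | inj₁ eq = subst (ℚ._≤ ℚ.∣ p ℚ.- q ∣) (sym eq) (∣p∣-∣q∣≤∣p-q∣ p q)
... | inj₂ eq = begin
  ℚ.∣ ℚ.∣ p ∣ ℚ.- ℚ.∣ q ∣ ∣   ≡⟨ eq ⟩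
  ℚ.- (ℚ.∣ p ∣ ℚ.- ℚ.∣ q ∣)   ≡⟨ lem ℚ.∣ p ∣ ℚ.∣ q ∣ ⟩
  ℚ.∣ q ∣ ℚ.- ℚ.∣ p ∣         ≤⟨ ∣p∣-∣q∣≤∣p-q∣ q p ⟩
  ℚ.∣ q ℚ.- p ∣               ≡⟨ ∣p-q∣≡∣q-p∣ q p ⟩
  ℚ.∣ p ℚ.- q ∣               ∎
  where
  open ℚ.≤-Reasoning
  open +-*-Solver
  lem : ∀ a b → ℚ.- (a ℚ.- b) ≡ b ℚ.- a
  lem = solve 2 (λ a b → :- (a :- b) := b :- a) refl

IsCauchy : (ℕ → ℚ) → Set
IsCauchy x = ∀ ε → 0ℚ ℚ.< ε →
  ∃[ N ] ∀ m n → N ℕ.≤ m → N ℕ.≤ n → ℚ.∣ x m ℚ.- x n ∣ ℚ.≤ ε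

record ℝ : Set where
  constructor mkℝ
  field
    seq    : ℕ → ℚ
    cauchy : IsCauchy seq

open ℝ public

infix 4 _≈_ _≤_ _<_

_≈_ : ℝ → ℝ → Set
x ≈ y = ∀ ε → 0ℚ ℚ.< ε → ∃[ N ] ∀ n → N ℕ.≤ n → ℚ.∣ seq x n ℚ.- seq y n ∣ ℚ.≤ ε

_≤_ : ℝ → ℝ → Set
x ≤ y = ∀ ε → 0ℚ ℚ.< ε → ∃[ N ] ∀ n → N ℕ.≤ n → seq x n ℚ.≤ seq y n ℚ.+ ε

_<_ : ℝ → ℝ → Set
x < y = ∃[ ε ] 0ℚ ℚ.< ε × ∃[ N ] ∀ n → N ℕ.≤ n → seq x n ℚ.+ ε ℚ.≤ seq y n

-- Abstract for performance: with these proofs unfolded, typechecking the records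
-- further down does not finish in reasonable time.
abstract

  const-cauchy : ∀ q → IsCauchy (λ _ → q)
  const-cauchy q ε ε>0 =
    0 , λ _ _ _ _ → subst (λ r → ℚ.∣ r ∣ ℚ.≤ ε) (sym (ℚ.+-inverseʳ q)) (ℚ.<⇒≤ ε>0)

  +-cauchy : ∀ {x y} → IsCauchy x → IsCauchy y → IsCauchy (λ n → x n ℚ.+ y n)
  +-cauchy {x} {y} cx cy ε ε>0
    with M , hM ← cx (½ ℚ.* ε) (half>0 ε>0)
       | N , hN ← cy (½ ℚ.* ε) (half>0 ε>0)
    = M ℕ.⊔ N , λ m n m≥ n≥ → begin
      ℚ.∣ (x m ℚ.+ y m) ℚ.- (x n ℚ.+ y n) ∣          ≡⟨ cong ℚ.∣_∣ (lem (x m) (y m) (x n) (y n)) ⟩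
      ℚ.∣ (x m ℚ.- x n) ℚ.+ (y m ℚ.- y n) ∣          ≤⟨ ℚ.∣p+q∣≤∣p∣+∣q∣ (x m ℚ.- x n) (y m ℚ.- y n) ⟩
      ℚ.∣ x m ℚ.- x n ∣ ℚ.+ ℚ.∣ y m ℚ.- y n ∣        ≤⟨ ℚ.+-mono-≤
        (hM m n (ℕ.≤-trans (ℕ.m≤m⊔n M N) m≥) (ℕ.≤-trans (ℕ.m≤m⊔n M N) n≥))
        (hN m n (ℕ.≤-trans (ℕ.m≤n⊔m M N) m≥) (ℕ.≤-trans (ℕ.m≤n⊔m M N) n≥)) ⟩
      ½ ℚ.* ε ℚ.+ ½ ℚ.* ε                            ≡⟨ half+half ε ⟩
      ε                                              ∎
    where
    open ℚ.≤-Reasoning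
    open +-*-Solver
    lem : ∀ a b c d → (a ℚ.+ b) ℚ.- (c ℚ.+ d) ≡ (a ℚ.- c) ℚ.+ (b ℚ.- d)
    lem = solve 4 (λ a b c d → (a :+ b) :- (c :+ d) := (a :- c) :+ (b :- d)) refl

  neg-cauchy : ∀ {x} → IsCauchy x → IsCauchy (λ n → ℚ.- x n)
  neg-cauchy {x} cx ε ε>0 with N , hN ← cx ε ε>0 = N , λ m n m≥ n≥ →
    subst (ℚ._≤ ε) (sym (trans (cong ℚ.∣_∣ (lem (x m) (x n))) (ℚ.∣-p∣≡∣p∣ (x m ℚ.- x n)))) (hN m n m≥ n≥)
    where
    open +-*-Solver
    lem : ∀ a b → (ℚ.- a) ℚ.- (ℚ.- b) ≡ ℚ.- (a ℚ.- b)
    lem = solve 2 (λ a b → (:- a) :- (:- b) := :- (a :- b)) refl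

  ∣∣-cauchy : ∀ {x} → IsCauchy x → IsCauchy (λ n → ℚ.∣ x n ∣)
  ∣∣-cauchy {x} cx ε ε>0 with N , hN ← cx ε ε>0 = N , λ m n m≥ n≥ →
    ℚ.≤-trans (∣∣p∣-∣q∣∣≤∣p-q∣ (x m) (x n)) (hN m n m≥ n≥)

  1ℚ>0 : 0ℚ ℚ.< 1ℚ
  1ℚ>0 = ℚ.positive⁻¹ 1ℚ

  eventually-bounded : ∀ {x} → IsCauchy x →
    ∃[ K ] 0ℚ ℚ.< K × ∃[ N ] ∀ n → N ℕ.≤ n → ℚ.∣ x n ∣ ℚ.≤ K
  eventually-bounded {x} cx with N , hN ← cx 1ℚ 1ℚ>0 =
    1ℚ ℚ.+ ℚ.∣ x N ∣ , ℚ.+-mono-<-≤ 1ℚ>0 (ℚ.0≤∣p∣ (x N)) , N , λ n n≥ → begin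
      ℚ.∣ x n ∣                               ≡⟨ cong ℚ.∣_∣ (lem (x n) (x N)) ⟩
      ℚ.∣ (x n ℚ.- x N) ℚ.+ x N ∣             ≤⟨ ℚ.∣p+q∣≤∣p∣+∣q∣ (x n ℚ.- x N) (x N) ⟩
      ℚ.∣ x n ℚ.- x N ∣ ℚ.+ ℚ.∣ x N ∣         ≤⟨ ℚ.+-monoˡ-≤ ℚ.∣ x N ∣ (hN n N n≥ ℕ.≤-refl) ⟩
      1ℚ ℚ.+ ℚ.∣ x N ∣                        ∎
    where
    open ℚ.≤-Reasoning
    open +-*-Solver
    lem : ∀ p q → p ≡ (p ℚ.- q) ℚ.+ q
    lem = solve 2 (λ p q → p := (p :- q) :+ q) refl

  ∣p*q∣≤ : ∀ {p q a b} → ℚ.∣ p ∣ ℚ.≤ a → ℚ.∣ q ∣ ℚ.≤ b → ℚ.∣ p ℚ.* q ∣ ℚ.≤ a ℚ.* b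
  ∣p*q∣≤ {p} {q} {a} {b} p≤ q≤ = begin
    ℚ.∣ p ℚ.* q ∣           ≡⟨ ℚ.∣p*q∣≡∣p∣*∣q∣ p q ⟩
    ℚ.∣ p ∣ ℚ.* ℚ.∣ q ∣     ≤⟨ ℚ.*-monoˡ-≤-nonNeg ℚ.∣ p ∣ {{ℚ.∣-∣-nonNeg p}} q≤ ⟩
    ℚ.∣ p ∣ ℚ.* b           ≤⟨ ℚ.*-monoʳ-≤-nonNeg b {{ℚ.nonNegative (ℚ.≤-trans (ℚ.0≤∣p∣ q) q≤)}} p≤ ⟩
    a ℚ.* b                 ∎
    where open ℚ.≤-Reasoning

  divide : ∀ k η → 0ℚ ℚ.< k → 0ℚ ℚ.< η → ∃[ δ ] 0ℚ ℚ.< δ × k ℚ.* δ ≡ η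
  divide k η k>0 η>0 = k⁻¹ ℚ.* η , ℚ.positive⁻¹ (k⁻¹ ℚ.* η) , (begin
    k ℚ.* (k⁻¹ ℚ.* η)   ≡⟨ ℚ.*-assoc k k⁻¹ η ⟨
    k ℚ.* k⁻¹ ℚ.* η     ≡⟨ cong (ℚ._* η) (ℚ.*-inverseʳ k) ⟩
    1ℚ ℚ.* η            ≡⟨ ℚ.*-identityˡ η ⟩
    η                   ∎)
    where
    open ≡-Reasoning
    instance
      k-positive : ℚ.Positive k
      k-positive = ℚ.positive k>0
      k-nonZero : ℚ.NonZero k
      k-nonZero = ℚ.pos⇒nonZero k
    k⁻¹ : ℚ
    k⁻¹ = ℚ.1/ k
    instance
      k⁻¹*η-positive : ℚ.Positive (k⁻¹ ℚ.* η)
      k⁻¹*η-positive = ℚ.pos*pos⇒pos k⁻¹ {{ℚ.1/pos⇒pos k}} η {{ℚ.positive η>0}}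

  ∣ab-cd∣≤ : ∀ a b c d K L δ η → ℚ.∣ a ∣ ℚ.≤ K → ℚ.∣ b ℚ.- d ∣ ℚ.≤ δ →
             ℚ.∣ d ∣ ℚ.≤ L → ℚ.∣ a ℚ.- c ∣ ℚ.≤ η →
             ℚ.∣ a ℚ.* b ℚ.- c ℚ.* d ∣ ℚ.≤ K ℚ.* δ ℚ.+ L ℚ.* η
  ∣ab-cd∣≤ a b c d K L δ η a≤ bd≤ d≤ ac≤ = begin
    ℚ.∣ a ℚ.* b ℚ.- c ℚ.* d ∣                               ≡⟨ cong ℚ.∣_∣ (lem a b c d) ⟩
    ℚ.∣ a ℚ.* (b ℚ.- d) ℚ.+ d ℚ.* (a ℚ.- c) ∣               ≤⟨ ℚ.∣p+q∣≤∣p∣+∣q∣ (a ℚ.* (b ℚ.- d)) (d ℚ.* (a ℚ.- c)) ⟩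
    ℚ.∣ a ℚ.* (b ℚ.- d) ∣ ℚ.+ ℚ.∣ d ℚ.* (a ℚ.- c) ∣         ≤⟨ ℚ.+-mono-≤ (∣p*q∣≤ {a} {b ℚ.- d} a≤ bd≤) (∣p*q∣≤ {d} {a ℚ.- c} d≤ ac≤) ⟩
    K ℚ.* δ ℚ.+ L ℚ.* η                                     ∎
    where
    open ℚ.≤-Reasoning
    open +-*-Solver
    lem : ∀ a b c d → a ℚ.* b ℚ.- c ℚ.* d ≡ a ℚ.* (b ℚ.- d) ℚ.+ d ℚ.* (a ℚ.- c)
    lem = solve 4 (λ a b c d → a :* b :- c :* d := a :* (b :- d) :+ d :* (a :- c)) refl

  *-cauchy : ∀ {x y} → IsCauchy x → IsCauchy y → IsCauchy (λ n → x n ℚ.* y n)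
  *-cauchy {x} {y} cx cy ε ε>0 =
    let K , K>0 , A , hA = eventually-bounded {x} cx
        L , L>0 , B , hB = eventually-bounded {y} cy
        δ , δ>0 , Kδ≡    = divide K (½ ℚ.* ε) K>0 (half>0 ε>0)
        η , η>0 , Lη≡    = divide L (½ ℚ.* ε) L>0 (half>0 ε>0)
        C , hC           = cx η η>0
        D , hD           = cy δ δ>0
    in combine K L δ η A B C D (trans (cong₂ ℚ._+_ Kδ≡ Lη≡) (half+half ε)) hA hB hC hD
    where
    combine : ∀ K L δ η A B C D → K ℚ.* δ ℚ.+ L ℚ.* η ≡ ε →
      (∀ n → A ℕ.≤ n → ℚ.∣ x n ∣ ℚ.≤ K) →
      (∀ n → B ℕ.≤ n → ℚ.∣ y n ∣ ℚ.≤ L) →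
      (∀ m n → C ℕ.≤ m → C ℕ.≤ n → ℚ.∣ x m ℚ.- x n ∣ ℚ.≤ η) →
      (∀ m n → D ℕ.≤ m → D ℕ.≤ n → ℚ.∣ y m ℚ.- y n ∣ ℚ.≤ δ) →
      ∃[ N ] ∀ m n → N ℕ.≤ m → N ℕ.≤ n → ℚ.∣ x m ℚ.* y m ℚ.- x n ℚ.* y n ∣ ℚ.≤ ε
    combine K L δ η A B C D eq hA hB hC hD = N , λ m n m≥ n≥ →
      subst (ℚ.∣ x m ℚ.* y m ℚ.- x n ℚ.* y n ∣ ℚ.≤_) eq
        (∣ab-cd∣≤ (x m) (y m) (x n) (y n) K L δ η
          (hA m (≥A m≥)) (hD m n (≥D m≥) (≥D n≥)) (hB n (≥B n≥)) (hC m n (≥C m≥) (≥C n≥)))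
      where
      N : ℕ
      N = (A ℕ.⊔ B) ℕ.⊔ (C ℕ.⊔ D)
      ≥A : ∀ {m} → N ℕ.≤ m → A ℕ.≤ m
      ≥A = ℕ.m⊔n≤o⇒m≤o A B ∘ ℕ.m⊔n≤o⇒m≤o (A ℕ.⊔ B) (C ℕ.⊔ D)
      ≥B : ∀ {m} → N ℕ.≤ m → B ℕ.≤ m
      ≥B = ℕ.m⊔n≤o⇒n≤o A B ∘ ℕ.m⊔n≤o⇒m≤o (A ℕ.⊔ B) (C ℕ.⊔ D)
      ≥C : ∀ {m} → N ℕ.≤ m → C ℕ.≤ m
      ≥C = ℕ.m⊔n≤o⇒m≤o C D ∘ ℕ.m⊔n≤o⇒n≤o (A ℕ.⊔ B) (C ℕ.⊔ D)
      ≥D : ∀ {m} → N ℕ.≤ m → D ℕ.≤ m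
      ≥D = ℕ.m⊔n≤o⇒n≤o C D ∘ ℕ.m⊔n≤o⇒n≤o (A ℕ.⊔ B) (C ℕ.⊔ D)

fromℚ : ℚ → ℝ
fromℚ q = mkℝ (λ _ → q) (const-cauchy q)

0ℝ 1ℝ : ℝ
0ℝ = fromℚ 0ℚ
1ℝ = fromℚ 1ℚ

infix  8 -_
infixl 7 _*_
infixl 6 _+_ _-_

_+_ _*_ : ℝ → ℝ → ℝ
x + y = mkℝ (λ n → seq x n ℚ.+ seq y n) (+-cauchy {seq x} {seq y} (cauchy x) (cauchy y))
x * y = mkℝ (λ n → seq x n ℚ.* seq y n) (*-cauchy {seq x} {seq y} (cauchy x) (cauchy y))

-_ ∣_∣ : ℝ → ℝ
- x   = mkℝ (λ n → ℚ.- seq x n) (neg-cauchy {seq x} (cauchy x))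
∣ x ∣ = mkℝ (λ n → ℚ.∣ seq x n ∣) (∣∣-cauchy {seq x} (cauchy x))

_-_ : ℝ → ℝ → ℝ
x - y = x + (- y)

ℝ-rawSemiring : RawSemiring 0ℓ 0ℓ
ℝ-rawSemiring = record
  { Carrier = ℝ ; _≈_ = _≈_ ; _+_ = _+_ ; _*_ = _*_ ; 0# = 0ℝ ; 1# = 1ℝ }

open RawSemiringDefs ℝ-rawSemiring public
  using (_^_) renaming (sum to sumℝ; _×_ to _·_)

Converges : (ℕ → ℝ) → ℝ → Set
Converges s l = ∀ ε → 0ℝ < ε → ∃[ N ] ∀ n → N ℕ.≤ n → ∣ s n - l ∣ < ε

IsInfimum : (ℝ → Set) → ℝ → Set
IsInfimum P v = (∀ w → P w → v ≤ w) × (∀ l → (∀ w → P w → l ≤ w) → l ≤ v)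

module _ (M : RawMonoid 0ℓ 0ℓ) where

  open RawMonoid M using (Carrier; ε)

  sumOver : ∀ {n} → Subset n → (Fin n → Carrier) → Carrier
  sumOver p f = RawMonoidDefs.sum M λ i → if lookup p i then f i else ε

ℕ-rawMonoid : RawMonoid 0ℓ 0ℓ
ℕ-rawMonoid = ℕ.+-0-rawMonoid

open RawMonoidDefs ℕ-rawMonoid public using () renaming (sum to sumℕ)

module Counts (n : ℕ) where

  infixl 6 _⊕_

  _⊕_ : Vec ℕ n → Vec ℕ n → Vec ℕ n
  _⊕_ = zipWith ℕ._+_

  rawMonoid : RawMonoid 0ℓ 0ℓ
  rawMonoid = record
    { Carrier = Vec ℕ n ; _≈_ = _≡_ ; _∙_ = _⊕_ ; ε = replicate n 0 }

  open RawMonoidDefs rawMonoid public using (sum) renaming (_×_ to _⊙_)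

  e : Fin n → Vec ℕ n
  e k = replicate n 0 [ k ]≔ 1

record BipartiteGraph : Set₁ where
  field
    nD nS : ℕ
    nD≥1  : 1 ℕ.≤ nD
    nS≥1  : 1 ℕ.≤ nS
    Edge  : REL (Fin nD) (Fin nS) 0ℓ
    edge? : Decidable Edge

IsComplete : BipartiteGraph → Set
IsComplete G = Universal Edge
  where open BipartiteGraph G

module Matching (G : BipartiteGraph) where

  open BipartiteGraph G public
  open Counts (nD ℕ.+ nS) public

  Node : Set
  Node = Fin (nD ℕ.+ nS)

  d : Fin nD → Node
  d i = i ↑ˡ nS

  s : Fin nS → Node
  s j = nD ↑ʳ j

  𝒮 : Fin nD → Subset nS
  𝒮 i = tabulate λ j → does (edge? i j)

  𝒟 : Fin nS → Subset nD
  𝒟 j = tabulate λ i → does (edge? i j)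

  𝒮[_] : Subset nD → Subset nS
  𝒮[ D ] = ⋃ (List.map 𝒮 (List.filter (_∈? D) (List.allFin nD)))

  𝒟[_] : Subset nS → Subset nD
  𝒟[ S ] = ⋃ (List.map 𝒟 (List.filter (_∈? S) (List.allFin nS)))

  𝒜 : Set
  𝒜 = Fin nD × Fin nS

  eₐ : 𝒜 → Vec ℕ (nD ℕ.+ nS)
  eₐ (i , j) = e (d i) ⊕ e (s j)

  IsBalanced : Vec ℕ (nD ℕ.+ nS) → Set
  IsBalanced x = sumℕ (λ i → lookup x (d i)) ≡ sumℕ (λ j → lookup x (s j))

  𝒬 : Set
  𝒬 = Σ (Vec ℕ (nD ℕ.+ nS)) IsBalanced

  𝒴 : Set
  𝒴 = 𝒬 × 𝒜

  -- Only the values μ i j with (i , j) an edge are relevant.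
  IsMatching : (Fin nD → Fin nS → ℕ) → Vec ℕ (nD ℕ.+ nS) → Set
  IsMatching μ u = u ≡ sum λ i → sumOver rawMonoid (𝒮 i) λ j → μ i j ⊙ eₐ (i , j)

  record IsAdmissible (x u : Vec ℕ (nD ℕ.+ nS)) : Set where
    field
      μ           : Fin nD → Fin nS → ℕ
      isMatching  : IsMatching μ u
      demandBound : ∀ i → sumOver ℕ-rawMonoid (𝒮 i) (λ j → μ i j) ℕ.≤ lookup x (d i)
      supplyBound : ∀ j → sumOver ℕ-rawMonoid (𝒟 j) (λ i → μ i j) ℕ.≤ lookup x (s j)

  U : 𝒬 → Set
  U x = ∃[ u ] IsAdmissible (proj₁ x) u

  module Σℕ = CommutativeMonoidSum ℕ.+-0-commutativeMonoid

  lookup-⊕ : ∀ x y k → lookup (x ⊕ y) k ≡ lookup x k ℕ.+ lookup y k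
  lookup-⊕ x y k = Vec.lookup-zipWith ℕ._+_ k x y

  lookup-⊙ : ∀ m x k → lookup (m ⊙ x) k ≡ m ℕ.* lookup x k
  lookup-⊙ zero    x k = Vec.lookup-replicate k 0
  lookup-⊙ (suc m) x k =
    trans (lookup-⊕ x (m ⊙ x) k) (cong (lookup x k ℕ.+_) (lookup-⊙ m x k))

  lookup-sum : ∀ {n} (f : Fin n → Vec ℕ (nD ℕ.+ nS)) k →
               lookup (sum f) k ≡ sumℕ (λ i → lookup (f i) k)
  lookup-sum {zero}  f k = Vec.lookup-replicate k 0
  lookup-sum {suc n} f k =
    trans (lookup-⊕ (f zero) _ k) (cong (lookup (f zero) k ℕ.+_) (lookup-sum (f ∘ suc) k))

  lookup-e-≡ : ∀ k → lookup (e k) k ≡ 1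
  lookup-e-≡ k = Vec.lookup∘update k (replicate _ 0) 1

  lookup-e-≢ : ∀ {k l} → l ≢ k → lookup (e k) l ≡ 0
  lookup-e-≢ {k} {l} l≢k =
    trans (Vec.lookup∘update′ l≢k (replicate _ 0) 1) (Vec.lookup-replicate l 0)

  d≢s : ∀ {i j} → d i ≢ s j
  d≢s {i} {j} eq with () ← trans (sym (Fin.splitAt-↑ˡ nD i nS))
                             (trans (cong (splitAt nD) eq) (Fin.splitAt-↑ʳ nD nS j))

  δ : ∀ {n} → Fin n → Fin n → ℕ
  δ i j = if does (i Fin.≟ j) then 1 else 0

  lookup-eₐ-d : ∀ i j i′ → lookup (eₐ (i , j)) (d i′) ≡ δ i i′
  lookup-eₐ-d i j i′ = trans (lookup-⊕ (e (d i)) (e (s j)) (d i′))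
    (trans (cong (lookup (e (d i)) (d i′) ℕ.+_) (lookup-e-≢ d≢s)) (trans (ℕ.+-identityʳ _) h))
    where
    h : lookup (e (d i)) (d i′) ≡ δ i i′
    h with i Fin.≟ i′
    ... | yes refl = lookup-e-≡ (d i)
    ... | no i≢i′  = lookup-e-≢ (i≢i′ ∘ sym ∘ Fin.↑ˡ-injective nS i′ i)

  lookup-eₐ-s : ∀ i j j′ → lookup (eₐ (i , j)) (s j′) ≡ δ j j′
  lookup-eₐ-s i j j′ = trans (lookup-⊕ (e (d i)) (e (s j)) (s j′))
    (trans (cong (ℕ._+ lookup (e (s j)) (s j′)) (lookup-e-≢ (d≢s ∘ sym))) h)
    where
    h : lookup (e (s j)) (s j′) ≡ δ j j′
    h with j Fin.≟ j′
    ... | yes refl = lookup-e-≡ (s j)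
    ... | no j≢j′  = lookup-e-≢ (j≢j′ ∘ sym ∘ Fin.↑ʳ-injective nD j′ j)

  sum-zero : ∀ {n} {f : Fin n → ℕ} → (∀ i → f i ≡ 0) → sumℕ f ≡ 0
  sum-zero {n} h = trans (Σℕ.sum-cong-≗ h) (Σℕ.sum-replicate-zero n)

  sum-δ : ∀ {n} (f : Fin n → ℕ) k → sumℕ (λ i → f i ℕ.* δ i k) ≡ f k
  sum-δ f zero =
    trans (cong₂ ℕ._+_ (ℕ.*-identityʳ (f zero)) (sum-zero λ i → ℕ.*-zeroʳ (f (suc i))))
          (ℕ.+-identityʳ _)
  sum-δ {suc n} f (suc k) =
    cong₂ ℕ._+_ (ℕ.*-zeroʳ (f zero)) (trans (Σℕ.sum-cong-≗ h) (sum-δ (f ∘ suc) k))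
    where
    h : ∀ i → f (suc i) ℕ.* δ (suc i) (suc k) ≡ f (suc i) ℕ.* δ i k
    h i with i Fin.≟ k
    ... | yes _ = refl
    ... | no  _ = refl

  ν : (Fin nD → Fin nS → ℕ) → Fin nD → Fin nS → ℕ
  ν μ i j = if does (edge? i j) then μ i j else 0

  lookup-term : ∀ μ i j k →
    lookup (if lookup (𝒮 i) j then μ i j ⊙ eₐ (i , j) else replicate _ 0) k
    ≡ ν μ i j ℕ.* lookup (eₐ (i , j)) k
  lookup-term μ i j k
    rewrite Vec.lookup∘tabulate (λ j → does (edge? i j)) j
    with does (edge? i j)
  ... | true  = lookup-⊙ (μ i j) (eₐ (i , j)) k
  ... | false = Vec.lookup-replicate k 0

  lookup-u : ∀ μ {u} → IsMatching μ u → ∀ k →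
    lookup u k ≡ sumℕ λ i → sumℕ λ j → ν μ i j ℕ.* lookup (eₐ (i , j)) k
  lookup-u μ refl k =
    trans (lookup-sum {nD} _ k)
          (Σℕ.sum-cong-≗ λ i → trans (lookup-sum {nS} _ k) (Σℕ.sum-cong-≗ λ j → lookup-term μ i j k))

  lookup-u-d : ∀ μ {u} → IsMatching μ u → ∀ i → lookup u (d i) ≡ sumℕ (ν μ i)
  lookup-u-d μ {u} h i = begin
    lookup u (d i)
      ≡⟨ lookup-u μ h (d i) ⟩
    sumℕ (λ i′ → sumℕ λ j → ν μ i′ j ℕ.* lookup (eₐ (i′ , j)) (d i))
      ≡⟨ Σℕ.∑-comm (λ i′ j → ν μ i′ j ℕ.* lookup (eₐ (i′ , j)) (d i)) ⟩
    sumℕ (λ j → sumℕ λ i′ → ν μ i′ j ℕ.* lookup (eₐ (i′ , j)) (d i))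
      ≡⟨ Σℕ.sum-cong-≗ (λ j → trans
           (Σℕ.sum-cong-≗ λ i′ → cong (ν μ i′ j ℕ.*_) (lookup-eₐ-d i′ j i))
           (sum-δ (λ i′ → ν μ i′ j) i)) ⟩
    sumℕ (ν μ i) ∎
    where open ≡-Reasoning

  lookup-u-s : ∀ μ {u} → IsMatching μ u → ∀ j → lookup u (s j) ≡ sumℕ (λ i → ν μ i j)
  lookup-u-s μ h j = trans (lookup-u μ h (s j)) (Σℕ.sum-cong-≗ λ i → trans
    (Σℕ.sum-cong-≗ λ j′ → cong (ν μ i j′ ℕ.*_) (lookup-eₐ-s i j′ j))
    (sum-δ (ν μ i) j))

  matching-balanced : ∀ μ {u} → IsMatching μ u → IsBalanced u
  matching-balanced μ h = trans (Σℕ.sum-cong-≗ (lookup-u-d μ h))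
    (trans (Σℕ.∑-comm (ν μ)) (sym (Σℕ.sum-cong-≗ (lookup-u-s μ h))))

  sumOver-𝒮 : ∀ μ i → sumOver ℕ-rawMonoid (𝒮 i) (μ i) ≡ sumℕ (ν μ i)
  sumOver-𝒮 μ i = Σℕ.sum-cong-≗ λ j →
    cong (λ b → if b then μ i j else 0) (Vec.lookup∘tabulate (λ j → does (edge? i j)) j)

  sumOver-𝒟 : ∀ μ j → sumOver ℕ-rawMonoid (𝒟 j) (λ i → μ i j) ≡ sumℕ (λ i → ν μ i j)
  sumOver-𝒟 μ j = Σℕ.sum-cong-≗ λ i →
    cong (λ b → if b then μ i j else 0) (Vec.lookup∘tabulate (λ i → does (edge? i j)) i)

  eₐ-balanced : ∀ a → IsBalanced (eₐ a)
  eₐ-balanced (i , j) = trans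
    (trans (Σℕ.sum-cong-≗ λ i′ → trans (lookup-eₐ-d i j i′) (δ-sym i i′)) (sum1 i))
    (sym (trans (Σℕ.sum-cong-≗ λ j′ → trans (lookup-eₐ-s i j j′) (δ-sym j j′)) (sum1 j)))
    where
    δ-sym : ∀ {n} (k l : Fin n) → δ k l ≡ 1 ℕ.* δ l k
    δ-sym k l with k Fin.≟ l | l Fin.≟ k
    ... | yes _  | yes _  = refl
    ... | no _   | no _   = refl
    ... | yes eq | no neq = contradiction (sym eq) neq
    ... | no neq | yes eq = contradiction (sym eq) neq
    sum1 : ∀ {n} (k : Fin n) → sumℕ (λ l → 1 ℕ.* δ l k) ≡ 1
    sum1 k = sum-δ (λ _ → 1) k

  ⊕-balanced : ∀ {x y} → IsBalanced x → IsBalanced y → IsBalanced (x ⊕ y)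
  ⊕-balanced {x} {y} hx hy = trans (split d) (trans (cong₂ ℕ._+_ hx hy) (sym (split s)))
    where
    split : ∀ {n} (g : Fin n → Node) → sumℕ (λ i → lookup (x ⊕ y) (g i))
            ≡ sumℕ (λ i → lookup x (g i)) ℕ.+ sumℕ (λ i → lookup y (g i))
    split g = trans (Σℕ.sum-cong-≗ λ i → lookup-⊕ x y (g i))
                    (Σℕ.∑-distrib-+ (λ i → lookup x (g i)) (λ i → lookup y (g i)))

  admissible⇒≤ : ∀ {x u} → IsAdmissible x u → ∀ k → lookup u k ℕ.≤ lookup x k
  admissible⇒≤ {x} {u} h k with splitAt nD k | Fin.join-splitAt nD nS k
  ... | inj₁ i | refl = subst (ℕ._≤ lookup x (d i))
    (trans (sumOver-𝒮 μ i) (sym (lookup-u-d μ isMatching i))) (demandBound i)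
    where open IsAdmissible h
  ... | inj₂ j | refl = subst (ℕ._≤ lookup x (s j))
    (trans (sumOver-𝒟 μ j) (sym (lookup-u-s μ isMatching j))) (supplyBound j)
    where open IsAdmissible h

  infixl 6 _⊞_ _⊟_

  _⊞_ : 𝒬 → 𝒜 → 𝒬
  (q , q-bal) ⊞ a = q ⊕ eₐ a , ⊕-balanced {q} {eₐ a} q-bal (eₐ-balanced a)

  -- The subtraction is never truncated, by admissible⇒≤.
  _⊟_ : (x : 𝒬) → U x → 𝒬
  (x , x-bal) ⊟ (u , adm) = zipWith _∸_ x u , ℕ.+-cancelʳ-≡ _ _ _ (begin
      sumℕ (λ i → lookup (zipWith _∸_ x u) (d i)) ℕ.+ sumℕ (λ i → lookup u (d i))  ≡⟨ restore d ⟩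
      sumℕ (λ i → lookup x (d i))                                                ≡⟨ x-bal ⟩
      sumℕ (λ j → lookup x (s j))                                                ≡⟨ restore s ⟨
      sumℕ (λ j → lookup (zipWith _∸_ x u) (s j)) ℕ.+ sumℕ (λ j → lookup u (s j))
        ≡⟨ cong (sumℕ (λ j → lookup (zipWith _∸_ x u) (s j)) ℕ.+_)
             (matching-balanced (IsAdmissible.μ adm) (IsAdmissible.isMatching adm)) ⟨
      sumℕ (λ j → lookup (zipWith _∸_ x u) (s j)) ℕ.+ sumℕ (λ i → lookup u (d i))  ∎)
    where
    open ≡-Reasoning
    restore : ∀ {n} (g : Fin n → Node) →
      sumℕ (λ i → lookup (zipWith _∸_ x u) (g i)) ℕ.+ sumℕ (λ i → lookup u (g i))
      ≡ sumℕ (λ i → lookup x (g i))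
    restore g = trans (sym (Σℕ.∑-distrib-+ (λ i → lookup (zipWith _∸_ x u) (g i)) (λ i → lookup u (g i))))
      (Σℕ.sum-cong-≗ λ i →
        trans (cong (ℕ._+ lookup u (g i)) (Vec.lookup-zipWith _∸_ (g i) x u))
              (ℕ.m∸n+n≡m (admissible⇒≤ adm (g i))))

record ArrivalLaw (G : BipartiteGraph) : Set where
  open BipartiteGraph G
  field
    α        : Fin nD → ℝ
    β        : Fin nS → ℝ
    positive : ∀ i j → 0ℝ < α i * β j
    sum-α    : sumℝ α ≈ 1ℝ
    sum-β    : sumℝ β ≈ 1ℝ

record IsStable {G : BipartiteGraph} (A : ArrivalLaw G) : Set where
  open Matching G
  open ArrivalLaw A
  ∑∈ : ∀ {n} → Subset n → (Fin n → ℝ) → ℝ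
  ∑∈ = sumOver (RawSemiring.+-rawMonoid ℝ-rawSemiring)
  field
    demand : ∀ (D : Subset nD) → Nonempty D → D ⊂ ⊤ → ∑∈ D α < ∑∈ 𝒮[ D ] β
    supply : ∀ (S : Subset nS) → Nonempty S → S ⊂ ⊤ → ∑∈ S β < ∑∈ 𝒟[ S ] α

record LinearCost (G : BipartiteGraph) : Set where
  open Matching G
  field
    coeff : Node → ℝ

  cost : 𝒬 → ℝ
  cost (x , _) = sumℝ λ k → lookup x k · coeff k

  field
    nonNegative   : ∀ x → 0ℝ ≤ cost x
    nonDecreasing : ∀ x i j → Edge i j → cost x ≤ cost (x ⊞ (i , j))

module Dynamics (G : BipartiteGraph) where

  open Matching G

  DecisionRule : Set
  DecisionRule = (x : 𝒬) → U x

  Policy : Set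
  Policy = ℕ → DecisionRule

  stationary : DecisionRule → Policy
  stationary rule _ = rule

  MatchesEverything : DecisionRule → Set
  MatchesEverything rule = ∀ x → proj₁ (x ⊟ rule x) ≡ replicate _ 0

  X : 𝒴 → 𝒬
  X (q , a) = q ⊞ a

  -- Y π y n ω is the state at time n when the arrivals A(n), …, A(1) are,
  -- latest first, the entries of ω.
  Y : Policy → 𝒴 → ∀ n → Vec 𝒜 n → 𝒴
  Y π y zero    []      = y
  Y π y (suc n) (a ∷ ω) = x ⊟ π n x , a
    where x = X (Y π y n ω)

  sumPaths : ∀ n → (Vec 𝒜 n → ℝ) → ℝ
  sumPaths zero    f = f []
  sumPaths (suc n) f = sumℝ λ i → sumℝ λ j → sumPaths n λ ω → f ((i , j) ∷ ω)

module DiscountedProblem {G : BipartiteGraph} (A : ArrivalLaw G) (C : LinearCost G) where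

  open Matching G
  open Dynamics G public
  open ArrivalLaw A
  open LinearCost C

  ℙ : ∀ {n} → Vec 𝒜 n → ℝ
  ℙ []            = 1ℝ
  ℙ ((i , j) ∷ ω) = (α i * β j) * ℙ ω

  𝔼 : ∀ n → (Vec 𝒜 n → ℝ) → ℝ
  𝔼 n f = sumPaths n λ ω → ℙ ω * f ω

  c : 𝒴 → ℝ
  c y = cost (X y)

  partialCost : ℝ → Policy → 𝒴 → ℕ → ℝ
  partialCost θ π y N = sumℝ {N} λ n → θ ^ toℕ n * 𝔼 (toℕ n) λ ω → c (Y π y (toℕ n) ω)

  -- The value v_θ^π(y) is a limit, hence given by its graph.  It exists for every
  -- π and y when 0 ≤ θ < 1: the expected cost at time n is nonnegative and grows
  -- at most linearly in n.
  IsDiscountedCost : ℝ → Policy → 𝒴 → ℝ → Set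
  IsDiscountedCost θ π y = Converges (partialCost θ π y)

  IsOptimalCost : ℝ → 𝒴 → ℝ → Set
  IsOptimalCost θ y = IsInfimum λ w → ∃[ π ] IsDiscountedCost θ π y w

  IsOptimal : ℝ → Policy → Set
  IsOptimal θ π = ∀ y → ∃[ v ] IsDiscountedCost θ π y v × IsOptimalCost θ y v

{-# OPTIONS --safe #-}

-- In a complete graph every balanced state q is a sum of pairs e_(i,j) along edges.
-- Hence q itself is an admissible matching, and c(q + a) ≥ c(a) since the cost does
-- not decrease when an edge is added.  From time 1 on, matching everything incurs
-- exactly the cost c(A(n)), so it is optimal pathwise.  Its discounted cost is
-- c(y) + θ c̄ / (1 − θ), where c̄ is the expected cost of one arriving pair.

module Submission where

open import Defs
import Algebra.Definitions.RawMonoid as RawMonoidDefs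
import Algebra.Properties.Semiring.Sum as SemiringSum
import Algebra.Structures.Biased as Biased
open import Algebra.Bundles using (CommutativeSemiring)
open import Data.Bool using (if_then_else_)
open import Data.Fin using (Fin; zero; suc; splitAt; toℕ)
import Data.Fin as Fin
import Data.Fin.Properties as Fin
open import Data.Integer using (+_; -[1+_])
import Data.Integer as ℤ
import Data.Integer.Properties as ℤ
open import Data.Integer.Solver using () renaming (module +-*-Solver to ℤ-Solver)
open import Data.Nat using (ℕ; zero; suc; _∸_)
import Data.Nat as ℕ
import Data.Nat.Properties as ℕ
open import Data.Product using (∃; ∃-syntax; _×_; _,_; proj₁; proj₂)
open import Data.Rational using (ℚ; mkℚ; 0ℚ; 1ℚ; ½)
import Data.Rational as ℚ
import Data.Rational.Properties as ℚ
open import Data.Rational.Solver using (module +-*-Solver)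
import Data.Rational.Unnormalised as ℚᵘ
import Data.Rational.Unnormalised.Properties as ℚᵘ
open import Data.Sum using (inj₁; inj₂; [_,_]′)
open import Data.Vec using (Vec; []; _∷_; lookup; replicate; zipWith)
import Data.Vec.Properties as Vec
import Data.Vec.Relation.Binary.Pointwise.Extensional as Pointwise
open import Function using (_∘_)
open import Level using (0ℓ)
open import Relation.Binary.Bundles using (Preorder)
open import Relation.Binary.PropositionalEquality
  using (_≡_; refl; sym; trans; cong; cong₂; subst; subst₂; module ≡-Reasoning)
import Relation.Binary.Reasoning.Preorder as PreorderReasoning
import Relation.Binary.Reasoning.Setoid as SetoidReasoning
open import Relation.Binary.Structures using (IsEquivalence)
open import Relation.Nullary using (yes; no)
open import Relation.Nullary.Decidable using (dec-true)

-- Reals are Cauchy sequences of rationals and a discounted cost is a limit, so optimality needs an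
-- actual real number as value. For matching everything the closed form is that number. After the
-- times 0, ..., N the part of the value still missing is exactly `θ ^ N * t`, where `t` solves a
-- fixed-point equation; convergence thus reduces to the decay of `θ ^ N`, and no infinite series is
-- ever formed. The number 1/(1 - θ) exists because `θ < 1ℝ` carries a rational gap, and the same
-- gap gives the rate of decay. Any other policy enters only together with a limit of its partial
-- costs. The inequality between partial costs passes to the limits, and the infimum is attained.

-- Eventual properties and inequalities of rationals

Eventually : (ℕ → Set) → Set
Eventually P = ∃[ N ] ∀ n → N ℕ.≤ n → P n

eventually-map : ∀ {P Q : ℕ → Set} → (∀ {n} → P n → Q n) → Eventually P → Eventually Q
eventually-map f (N , h) = N , λ n n≥ → f (h n n≥)

eventually-zip : ∀ {P Q R : ℕ → Set} → (∀ {n} → P n → Q n → R n) →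
                 Eventually P → Eventually Q → Eventually R
eventually-zip f (M , h) (N , k) = M ℕ.⊔ N , λ n n≥ →
  f (h n (ℕ.m⊔n≤o⇒m≤o M N n≥)) (k n (ℕ.m⊔n≤o⇒n≤o M N n≥))

always : ∀ {P : ℕ → Set} → (∀ n → P n) → Eventually P
always h = 0 , λ n _ → h n

∣p∣≤⇒p≤ : ∀ {p r} → ℚ.∣ p ∣ ℚ.≤ r → p ℚ.≤ r
∣p∣≤⇒p≤ {p} ≤r with ℚ.≤-total 0ℚ p
... | inj₁ 0≤p = subst (ℚ._≤ _) (ℚ.0≤p⇒∣p∣≡p 0≤p) ≤r
... | inj₂ p≤0 = ℚ.≤-trans p≤0 (ℚ.≤-trans (ℚ.0≤∣p∣ p) ≤r)

∣p∣≤⇒-p≤ : ∀ {p r} → ℚ.∣ p ∣ ℚ.≤ r → ℚ.- p ℚ.≤ r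
∣p∣≤⇒-p≤ {p} ≤r = ∣p∣≤⇒p≤ (subst (ℚ._≤ _) (sym (ℚ.∣-p∣≡∣p∣ p)) ≤r)

≤⇒∣p∣≤ : ∀ {p r} → p ℚ.≤ r → ℚ.- p ℚ.≤ r → ℚ.∣ p ∣ ℚ.≤ r
≤⇒∣p∣≤ {p} p≤ -p≤ with ℚ.∣p∣≡p∨∣p∣≡-p p
... | inj₁ eq = subst (ℚ._≤ _) (sym eq) p≤
... | inj₂ eq = subst (ℚ._≤ _) (sym eq) -p≤

0≤q-p⇒p≤q : ∀ {p q} → 0ℚ ℚ.≤ q ℚ.- p → p ℚ.≤ q
0≤q-p⇒p≤q {p} {q} h = subst₂ ℚ._≤_ (ℚ.+-identityˡ p) (lem q p) (ℚ.+-monoˡ-≤ p h)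
  where
  open +-*-Solver
  lem : ∀ q p → q ℚ.- p ℚ.+ p ≡ q
  lem = solve 2 (λ q p → q :- p :+ p := q) refl

p≤q⇒0≤q-p : ∀ {p q} → p ℚ.≤ q → 0ℚ ℚ.≤ q ℚ.- p
p≤q⇒0≤q-p {p} {q} h = subst (ℚ._≤ q ℚ.- p) (ℚ.+-inverseʳ p) (ℚ.+-monoˡ-≤ (ℚ.- p) h)

0≤*0≤ : ∀ {p q} → 0ℚ ℚ.≤ p → 0ℚ ℚ.≤ q → 0ℚ ℚ.≤ p ℚ.* q
0≤*0≤ {p} {q} 0≤p 0≤q =
  ℚ.nonNegative⁻¹ _ {{ℚ.nonNeg*nonNeg⇒nonNeg p {{ℚ.nonNegative 0≤p}} q {{ℚ.nonNegative 0≤q}}}}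

-- Null sequences and asymptotically nonnegative sequences

Null : (ℕ → ℚ) → Set
Null x = ∀ ε → 0ℚ ℚ.< ε → Eventually λ n → ℚ.∣ x n ∣ ℚ.≤ ε

-- This is lim inf ≥ 0. Since `x ≼ y` says it of the difference y - x, facts about the order become
-- closure properties of a single sequence.
LimNonNeg : (ℕ → ℚ) → Set
LimNonNeg x = ∀ ε → 0ℚ ℚ.< ε → Eventually λ n → 0ℚ ℚ.≤ x n ℚ.+ ε

null-cong : ∀ {x y} → (∀ n → x n ≡ y n) → Null x → Null y
null-cong x≗y h ε ε>0 =
  eventually-map (λ {n} → subst (λ r → ℚ.∣ r ∣ ℚ.≤ ε) (x≗y n)) (h ε ε>0)

null-0 : Null λ _ → 0ℚ
null-0 ε ε>0 = always λ _ → ℚ.<⇒≤ ε>0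

null-+ : ∀ {x y} → Null x → Null y → Null λ n → x n ℚ.+ y n
null-+ {x} {y} hx hy ε ε>0 =
  eventually-zip (λ {n} → add n) (hx (½ ℚ.* ε) (half>0 ε>0)) (hy (½ ℚ.* ε) (half>0 ε>0))
  where
  add : ∀ n → ℚ.∣ x n ∣ ℚ.≤ ½ ℚ.* ε → ℚ.∣ y n ∣ ℚ.≤ ½ ℚ.* ε → ℚ.∣ x n ℚ.+ y n ∣ ℚ.≤ ε
  add n p q = ℚ.≤-trans (ℚ.∣p+q∣≤∣p∣+∣q∣ (x n) (y n))
    (subst (ℚ.∣ x n ∣ ℚ.+ ℚ.∣ y n ∣ ℚ.≤_) (half+half ε) (ℚ.+-mono-≤ p q))

null-neg : ∀ {x} → Null x → Null λ n → ℚ.- x n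
null-neg {x} h ε ε>0 =
  eventually-map (λ {n} → subst (ℚ._≤ ε) (sym (ℚ.∣-p∣≡∣p∣ (x n)))) (h ε ε>0)

null-* : ∀ {x} y → IsCauchy x → Null y → Null λ n → x n ℚ.* y n
null-* {x} y cx hy ε ε>0
  with K , K>0 , bounded ← eventually-bounded {x} cx
  with δ , δ>0 , Kδ≡ε ← divide K ε K>0 ε>0
  = eventually-zip (λ {n} p q → subst (ℚ.∣ x n ℚ.* y n ∣ ℚ.≤_) Kδ≡ε (∣p*q∣≤ {x n} {y n} p q))
      bounded (hy δ δ>0)

limNonNeg-cong : ∀ {x y} → (∀ n → x n ≡ y n) → LimNonNeg x → LimNonNeg y
limNonNeg-cong x≗y h ε ε>0 =
  eventually-map (λ {n} → subst (λ r → 0ℚ ℚ.≤ r ℚ.+ ε) (x≗y n)) (h ε ε>0)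

limNonNeg-+ : ∀ x y → LimNonNeg x → LimNonNeg y → LimNonNeg λ n → x n ℚ.+ y n
limNonNeg-+ x y hx hy ε ε>0 =
  eventually-zip (λ {n} → add n) (hx (½ ℚ.* ε) (half>0 ε>0)) (hy (½ ℚ.* ε) (half>0 ε>0))
  where
  open +-*-Solver
  lem : ∀ a b c d → (a ℚ.+ c) ℚ.+ (b ℚ.+ d) ≡ (a ℚ.+ b) ℚ.+ (c ℚ.+ d)
  lem = solve 4 (λ a b c d → (a :+ c) :+ (b :+ d) := (a :+ b) :+ (c :+ d)) refl
  add : ∀ n → 0ℚ ℚ.≤ x n ℚ.+ ½ ℚ.* ε → 0ℚ ℚ.≤ y n ℚ.+ ½ ℚ.* ε → 0ℚ ℚ.≤ (x n ℚ.+ y n) ℚ.+ ε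
  add n p q = subst (0ℚ ℚ.≤_)
    (trans (lem (x n) (y n) _ _) (cong (x n ℚ.+ y n ℚ.+_) (half+half ε)))
    (ℚ.+-mono-≤ p q)

null⇒limNonNeg : ∀ {x} → Null x → LimNonNeg x
null⇒limNonNeg {x} h ε ε>0 = eventually-map
  (λ {n} p → subst (ℚ._≤ x n ℚ.+ ε) (ℚ.+-inverseʳ (x n)) (ℚ.+-monoʳ-≤ (x n) (∣p∣≤⇒-p≤ p)))
  (h ε ε>0)

≤⇒limNonNeg : ∀ {x} → Eventually (λ n → 0ℚ ℚ.≤ x n) → LimNonNeg x
≤⇒limNonNeg {x} h ε ε>0 =
  eventually-map (λ {n} p → ℚ.≤-trans (ℚ.<⇒≤ ε>0) (subst (ℚ._≤ x n ℚ.+ ε) (ℚ.+-identityˡ ε) (ℚ.+-monoˡ-≤ ε p))) h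

-- The terms themselves may all be slightly negative, so termwise signs do not help: both factors
-- are shifted up by a small η, and boundedness controls the error of the shift.
limNonNeg-* : ∀ {x y} → IsCauchy x → IsCauchy y →
              LimNonNeg x → LimNonNeg y → LimNonNeg λ n → x n ℚ.* y n
limNonNeg-* {x} {y} cx cy hx hy ε ε>0
  with K , K>0 , boundedˣ ← eventually-bounded {x} cx
  with L , L>0 , boundedʸ ← eventually-bounded {y} cy
  -- The shift costs at most ηK + ηL + η². Capping η at 1 makes η² ≤ η, hence the divisor K + L + 1.
  with δ , δ>0 , Sδ≡ε ← divide ((K ℚ.+ L) ℚ.+ 1ℚ) ε (ℚ.+-mono-< (ℚ.+-mono-< K>0 L>0) 1ℚ>0) ε>0
  = eventually-zip (λ {n} (p , p′) (q , q′) → mul n p p′ q q′)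
      (eventually-zip _,_ boundedˣ (hx η η>0)) (eventually-zip _,_ boundedʸ (hy η η>0))
  where
  open +-*-Solver
  η : ℚ
  η = δ ℚ.⊓ 1ℚ
  η>0 : 0ℚ ℚ.< η
  η>0 = [ (λ eq → subst (0ℚ ℚ.<_) (sym eq) δ>0) , (λ eq → subst (0ℚ ℚ.<_) (sym eq) 1ℚ>0) ]′
          (ℚ.⊓-sel δ 1ℚ)
  0≤η : 0ℚ ℚ.≤ η
  0≤η = ℚ.<⇒≤ η>0
  -- Expands (a + η) (b + η) ≥ 0, where a and b are bounded by K and L and η by 1.
  lem : ∀ a b K L η S → a ℚ.* b ℚ.+ S ≡
    (((a ℚ.+ η) ℚ.* (b ℚ.+ η) ℚ.+ η ℚ.* (K ℚ.- a)) ℚ.+ (η ℚ.* (L ℚ.- b) ℚ.+ η ℚ.* (1ℚ ℚ.- η)))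
    ℚ.+ (S ℚ.- ((K ℚ.+ L) ℚ.+ 1ℚ) ℚ.* η)
  lem = solve 6 (λ a b K L η S → a :* b :+ S :=
    (((a :+ η) :* (b :+ η) :+ η :* (K :- a)) :+ (η :* (L :- b) :+ η :* (con 1ℚ :- η)))
    :+ (S :- ((K :+ L) :+ con 1ℚ) :* η)) refl
  0≤S : 0ℚ ℚ.≤ (K ℚ.+ L) ℚ.+ 1ℚ
  0≤S = ℚ.<⇒≤ (ℚ.+-mono-< (ℚ.+-mono-< K>0 L>0) 1ℚ>0)
  mul : ∀ n → ℚ.∣ x n ∣ ℚ.≤ K → 0ℚ ℚ.≤ x n ℚ.+ η → ℚ.∣ y n ∣ ℚ.≤ L → 0ℚ ℚ.≤ y n ℚ.+ η →
        0ℚ ℚ.≤ x n ℚ.* y n ℚ.+ ε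
  mul n p p′ q q′ = subst (0ℚ ℚ.≤_) (sym (lem (x n) (y n) K L η ε))
    (ℚ.+-mono-≤
      (ℚ.+-mono-≤
        (ℚ.+-mono-≤ (0≤*0≤ p′ q′) (0≤*0≤ 0≤η (p≤q⇒0≤q-p (∣p∣≤⇒p≤ p))))
        (ℚ.+-mono-≤ (0≤*0≤ 0≤η (p≤q⇒0≤q-p (∣p∣≤⇒p≤ q))) (0≤*0≤ 0≤η (p≤q⇒0≤q-p (ℚ.p⊓q≤q δ 1ℚ)))))
      (p≤q⇒0≤q-p (subst (((K ℚ.+ L) ℚ.+ 1ℚ) ℚ.* η ℚ.≤_) Sδ≡ε
        (ℚ.*-monoˡ-≤-nonNeg ((K ℚ.+ L) ℚ.+ 1ℚ) {{ℚ.nonNegative 0≤S}} (ℚ.p⊓q≤p δ 1ℚ)))))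

-- The reals as an ordered commutative semiring

infix 4 _≃_ _≼_

-- Record versions of _≈_ and _≤_: unlike these, they do not unfold, so that the
-- related reals can be inferred.
record _≃_ (x y : ℝ) : Set where
  constructor mk≃
  field null : Null λ n → seq x n ℚ.- seq y n

record _≼_ (x y : ℝ) : Set where
  constructor mk≼
  field limNonNeg : LimNonNeg λ n → seq y n ℚ.- seq x n

≈⇒≃ : ∀ {x y} → x ≈ y → x ≃ y
≈⇒≃ h = mk≃ h

≤⇒≼ : ∀ {x y} → x ≤ y → x ≼ y
≤⇒≼ {x} {y} h = mk≼ λ ε ε>0 →
  eventually-map (λ {n} p → subst (0ℚ ℚ.≤_) (lem (seq y n) ε (seq x n)) (p≤q⇒0≤q-p p)) (h ε ε>0)
  where
  open +-*-Solver
  lem : ∀ y ε x → y ℚ.+ ε ℚ.- x ≡ y ℚ.- x ℚ.+ ε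
  lem = solve 3 (λ y ε x → y :+ ε :- x := y :- x :+ ε) refl

≼⇒≤ : ∀ {x y} → x ≼ y → x ≤ y
≼⇒≤ {x} {y} (mk≼ h) ε ε>0 =
  eventually-map (λ {n} p → 0≤q-p⇒p≤q (subst (0ℚ ℚ.≤_) (lem (seq y n) ε (seq x n)) p)) (h ε ε>0)
  where
  open +-*-Solver
  lem : ∀ y ε x → y ℚ.- x ℚ.+ ε ≡ y ℚ.+ ε ℚ.- x
  lem = solve 3 (λ y ε x → y :- x :+ ε := y :+ ε :- x) refl

pointwise⇒≃ : ∀ {x y} → (∀ n → seq x n ≡ seq y n) → x ≃ y
pointwise⇒≃ {x} {y} h = mk≃ (null-cong
  (λ n → sym (trans (cong (ℚ._- seq y n) (h n)) (ℚ.+-inverseʳ (seq y n)))) null-0)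

≃-refl : ∀ {x} → x ≃ x
≃-refl = pointwise⇒≃ λ _ → refl

≃-sym : ∀ {x y} → x ≃ y → y ≃ x
≃-sym {x} {y} (mk≃ h) = mk≃ (null-cong (λ n → lem (seq x n) (seq y n)) (null-neg h))
  where
  open +-*-Solver
  lem : ∀ a b → ℚ.- (a ℚ.- b) ≡ b ℚ.- a
  lem = solve 2 (λ a b → :- (a :- b) := b :- a) refl

≃-trans : ∀ {x y z} → x ≃ y → y ≃ z → x ≃ z
≃-trans {x} {y} {z} (mk≃ h) (mk≃ k) =
  mk≃ (null-cong (λ n → lem (seq x n) (seq y n) (seq z n)) (null-+ h k))
  where
  open +-*-Solver
  lem : ∀ a b c → (a ℚ.- b) ℚ.+ (b ℚ.- c) ≡ a ℚ.- c
  lem = solve 3 (λ a b c → (a :- b) :+ (b :- c) := a :- c) refl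

+-cong : ∀ {x y u v} → x ≃ y → u ≃ v → x + u ≃ y + v
+-cong {x} {y} {u} {v} (mk≃ h) (mk≃ k) =
  mk≃ (null-cong (λ n → lem (seq x n) (seq y n) (seq u n) (seq v n)) (null-+ h k))
  where
  open +-*-Solver
  lem : ∀ a b c d → (a ℚ.- b) ℚ.+ (c ℚ.- d) ≡ (a ℚ.+ c) ℚ.- (b ℚ.+ d)
  lem = solve 4 (λ a b c d → (a :- b) :+ (c :- d) := (a :+ c) :- (b :+ d)) refl

*-cong : ∀ {x y u v} → x ≃ y → u ≃ v → x * u ≃ y * v
*-cong {x} {y} {u} {v} (mk≃ h) (mk≃ k) = mk≃ (null-cong
  (λ n → lem (seq x n) (seq y n) (seq u n) (seq v n))
  (null-+ (null-* {seq u} (λ n → seq x n ℚ.- seq y n) (cauchy u) h)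
          (null-* {seq y} (λ n → seq u n ℚ.- seq v n) (cauchy y) k)))
  where
  open +-*-Solver
  lem : ∀ a b c d → c ℚ.* (a ℚ.- b) ℚ.+ b ℚ.* (c ℚ.- d) ≡ a ℚ.* c ℚ.- b ℚ.* d
  lem = solve 4 (λ a b c d → c :* (a :- b) :+ b :* (c :- d) := a :* c :- b :* d) refl

ℝ-commutativeSemiring : CommutativeSemiring 0ℓ 0ℓ
ℝ-commutativeSemiring = record
  { Carrier = ℝ ; _≈_ = _≃_ ; _+_ = _+_ ; _*_ = _*_ ; 0# = 0ℝ ; 1# = 1ℝ
  ; isCommutativeSemiring = Biased.IsCommutativeSemiringˡ.isCommutativeSemiring record
    { +-isCommutativeMonoid = Biased.IsCommutativeMonoidˡ.isCommutativeMonoid record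
      { isSemigroup = record
        { isMagma = record { isEquivalence = isEquivalence ; ∙-cong = +-cong }
        ; assoc   = λ x y z → pointwise⇒≃ λ n → ℚ.+-assoc (seq x n) (seq y n) (seq z n) }
      ; identityˡ = λ x → pointwise⇒≃ λ n → ℚ.+-identityˡ (seq x n)
      ; comm      = λ x y → pointwise⇒≃ λ n → ℚ.+-comm (seq x n) (seq y n) }
    ; *-isCommutativeMonoid = Biased.IsCommutativeMonoidˡ.isCommutativeMonoid record
      { isSemigroup = record
        { isMagma = record { isEquivalence = isEquivalence ; ∙-cong = *-cong }
        ; assoc   = λ x y z → pointwise⇒≃ λ n → ℚ.*-assoc (seq x n) (seq y n) (seq z n) }
      ; identityˡ = λ x → pointwise⇒≃ λ n → ℚ.*-identityˡ (seq x n)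
      ; comm      = λ x y → pointwise⇒≃ λ n → ℚ.*-comm (seq x n) (seq y n) }
    ; distribʳ = λ z x y → pointwise⇒≃ λ n → ℚ.*-distribʳ-+ (seq z n) (seq x n) (seq y n)
    ; zeroˡ    = λ x → pointwise⇒≃ λ n → ℚ.*-zeroˡ (seq x n)
    }
  }
  where
  isEquivalence : IsEquivalence _≃_
  isEquivalence = record { refl = ≃-refl ; sym = ≃-sym ; trans = ≃-trans }

module R = CommutativeSemiring ℝ-commutativeSemiring
module R-Sum = SemiringSum R.semiring
module ℚMult = RawMonoidDefs ℚ.+-0-rawMonoid

≃⇒≼ : ∀ {x y} → x ≃ y → x ≼ y
≃⇒≼ {x} {y} h = mk≼ (null⇒limNonNeg (_≃_.null (≃-sym h)))

≼-trans : ∀ {x y z} → x ≼ y → y ≼ z → x ≼ z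
≼-trans {x} {y} {z} (mk≼ h) (mk≼ k) =
  mk≼ (limNonNeg-cong (λ n → lem (seq x n) (seq y n) (seq z n))
    (limNonNeg-+ (λ n → seq y n ℚ.- seq x n) (λ n → seq z n ℚ.- seq y n) h k))
  where
  open +-*-Solver
  lem : ∀ a b c → (b ℚ.- a) ℚ.+ (c ℚ.- b) ≡ c ℚ.- a
  lem = solve 3 (λ a b c → (b :- a) :+ (c :- b) := c :- a) refl

≼-preorder : Preorder 0ℓ 0ℓ 0ℓ
≼-preorder = record
  { Carrier = ℝ ; _≈_ = _≃_ ; _≲_ = _≼_
  ; isPreorder = record
    { isEquivalence = R.isEquivalence
    ; reflexive = ≃⇒≼ ; trans = ≼-trans } }

module ≼-Reasoning = PreorderReasoning ≼-preorder

≼-refl : ∀ {x} → x ≼ x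
≼-refl = ≃⇒≼ ≃-refl

+-mono-≼ : ∀ {x y u v} → x ≼ y → u ≼ v → x + u ≼ y + v
+-mono-≼ {x} {y} {u} {v} (mk≼ h) (mk≼ k) = mk≼ (limNonNeg-cong
  (λ n → lem (seq x n) (seq y n) (seq u n) (seq v n))
  (limNonNeg-+ (λ n → seq y n ℚ.- seq x n) (λ n → seq v n ℚ.- seq u n) h k))
  where
  open +-*-Solver
  lem : ∀ a b c d → (b ℚ.- a) ℚ.+ (d ℚ.- c) ≡ (b ℚ.+ d) ℚ.- (a ℚ.+ c)
  lem = solve 4 (λ a b c d → (b :- a) :+ (d :- c) := (b :+ d) :- (a :+ c)) refl

≼⇒0≼- : ∀ {x y} → x ≼ y → 0ℝ ≼ y - x
≼⇒0≼- {x} {y} (mk≼ h) =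
  mk≼ (limNonNeg-cong (λ n → sym (ℚ.+-identityʳ (seq y n ℚ.- seq x n))) h)

0≼-⇒≼ : ∀ {x y} → 0ℝ ≼ y - x → x ≼ y
0≼-⇒≼ {x} {y} (mk≼ h) =
  mk≼ (limNonNeg-cong (λ n → ℚ.+-identityʳ (seq y n ℚ.- seq x n)) h)

0≼*0≼ : ∀ {x y} → 0ℝ ≼ x → 0ℝ ≼ y → 0ℝ ≼ x * y
0≼*0≼ {x} {y} (mk≼ h) (mk≼ k) = mk≼ (limNonNeg-cong
  (λ n → sym (ℚ.+-identityʳ (seq x n ℚ.* seq y n)))
  (limNonNeg-* {seq x} {seq y} (cauchy x) (cauchy y)
    (limNonNeg-cong (λ n → ℚ.+-identityʳ (seq x n)) h)
    (limNonNeg-cong (λ n → ℚ.+-identityʳ (seq y n)) k)))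

*-monoˡ-≼ : ∀ {x y z} → 0ℝ ≼ z → x ≼ y → z * x ≼ z * y
*-monoˡ-≼ {x} {y} {z} 0≼z x≼y = 0≼-⇒≼ (≼-trans (0≼*0≼ 0≼z (≼⇒0≼- x≼y))
  (≃⇒≼ (pointwise⇒≃ λ n → lem (seq x n) (seq y n) (seq z n))))
  where
  open +-*-Solver
  lem : ∀ a b c → c ℚ.* (b ℚ.- a) ≡ c ℚ.* b ℚ.- c ℚ.* a
  lem = solve 3 (λ a b c → c :* (b :- a) := c :* b :- c :* a) refl

eventually-≤⇒≼ : ∀ {x y} → Eventually (λ n → seq x n ℚ.≤ seq y n) → x ≼ y
eventually-≤⇒≼ h = mk≼ (≤⇒limNonNeg (eventually-map p≤q⇒0≤q-p h))

fromℚ-mono : ∀ {p q} → p ℚ.≤ q → fromℚ p ≼ fromℚ q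
fromℚ-mono p≤q = eventually-≤⇒≼ (always λ _ → p≤q)

<⇒≼ : ∀ {x y} → x < y → x ≼ y
<⇒≼ {x} {y} (ε , ε>0 , h) = eventually-≤⇒≼ (eventually-map
  (λ {n} → ℚ.≤-trans (subst (ℚ._≤ seq x n ℚ.+ ε) (ℚ.+-identityʳ (seq x n))
    (ℚ.+-monoʳ-≤ (seq x n) (ℚ.<⇒≤ ε>0)))) h)

fromℚ-upperBound : ∀ x → ∃[ K ] 0ℚ ℚ.< K × x ≼ fromℚ K
fromℚ-upperBound x with K , K>0 , h ← eventually-bounded {seq x} (cauchy x) =
  K , K>0 , eventually-≤⇒≼ (eventually-map ∣p∣≤⇒p≤ h)

-- `Converges` takes real tolerances and asks for strict inequality, while the estimates are weak
-- and rational. The gap ε₀ below ε is split: a half for η, a quarter for the slack inside `_≤_`, a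
-- quarter for the strictness of `_<_`.
≤-fromℚ-gap : ∀ {ε} → 0ℝ < ε → ∃[ η ] 0ℚ ℚ.< η × (∀ x → x ≼ fromℚ η → x < ε)
≤-fromℚ-gap {ε} (ε₀ , ε₀>0 , h) = ½ ℚ.* ε₀ , half>0 ε₀>0 , λ x x≼ →
  ¼ε₀ , half>0 (half>0 ε₀>0) ,
  eventually-zip
    (λ {n} p q → begin
      seq x n ℚ.+ ¼ε₀               ≤⟨ ℚ.+-monoˡ-≤ ¼ε₀ p ⟩
      ½ ℚ.* ε₀ ℚ.+ ¼ε₀ ℚ.+ ¼ε₀      ≡⟨ ℚ.+-assoc (½ ℚ.* ε₀) ¼ε₀ ¼ε₀ ⟩
      ½ ℚ.* ε₀ ℚ.+ (¼ε₀ ℚ.+ ¼ε₀)    ≡⟨ cong (½ ℚ.* ε₀ ℚ.+_) (half+half (½ ℚ.* ε₀)) ⟩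
      ½ ℚ.* ε₀ ℚ.+ ½ ℚ.* ε₀         ≡⟨ half+half ε₀ ⟩
      ε₀                            ≡⟨ ℚ.+-identityˡ ε₀ ⟨
      0ℚ ℚ.+ ε₀                     ≤⟨ q ⟩
      seq ε n                       ∎)
    (≼⇒≤ x≼ ¼ε₀ (half>0 (half>0 ε₀>0))) h
  where
  open ℚ.≤-Reasoning
  ¼ε₀ : ℚ
  ¼ε₀ = ½ ℚ.* (½ ℚ.* ε₀)

∣-∣-≼ : ∀ {x z} → x ≼ z → - x ≼ z → ∣ x ∣ ≼ z
∣-∣-≼ {x} {z} x≼ -x≼ = ≤⇒≼ λ ε ε>0 →
  eventually-zip ≤⇒∣p∣≤ (≼⇒≤ x≼ ε ε>0) (≼⇒≤ -x≼ ε ε>0)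

x≼∣x∣ : ∀ x → x ≼ ∣ x ∣
x≼∣x∣ x = eventually-≤⇒≼ (always λ n → ∣p∣≤⇒p≤ ℚ.≤-refl)

-x≼∣x∣ : ∀ x → - x ≼ ∣ x ∣
-x≼∣x∣ x = eventually-≤⇒≼ (always λ n → ∣p∣≤⇒-p≤ ℚ.≤-refl)

-- Half of each tolerance is spent on η, the other half on the slack that `_≤_` already allows.
≼-fromℚ-closed : ∀ {x y} → (∀ η → 0ℚ ℚ.< η → x ≼ y + fromℚ η) → x ≼ y
≼-fromℚ-closed {x} {y} h = ≤⇒≼ λ ε ε>0 →
  eventually-map (λ {n} → subst (seq x n ℚ.≤_) (halves n ε))
    (≼⇒≤ (h (½ ℚ.* ε) (half>0 ε>0)) (½ ℚ.* ε) (half>0 ε>0))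
  where
  halves : ∀ n ε → seq y n ℚ.+ ½ ℚ.* ε ℚ.+ ½ ℚ.* ε ≡ seq y n ℚ.+ ε
  halves n ε = trans (ℚ.+-assoc (seq y n) _ _) (cong (seq y n ℚ.+_) (half+half ε))

-- Reciprocals and the geometric series

positive-inverse : ∀ {x} → 0ℝ < x → ∃[ y ] x * y ≃ 1ℝ × 0ℝ ≼ y
positive-inverse {x} (ε , ε>0 , N , ε≤) =
  mkℝ r r-cauchy ,
  mk≃ (λ η η>0 → N , λ n n≥ → subst (λ p → ℚ.∣ p ∣ ℚ.≤ η) (sym (inverse n n≥)) (ℚ.<⇒≤ η>0)) ,
  eventually-≤⇒≼ (always λ n → ℚ.<⇒≤ (r>0 n))
  where
  open +-*-Solver
  -- Bounded below, so that every term is invertible, and eventually equal to x.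
  a : ℕ → ℚ
  a n = seq x n ℚ.⊔ ε
  ε≤a : ∀ n → ε ℚ.≤ a n
  ε≤a n = ℚ.p≤q⊔p (seq x n) ε
  a≡x : ∀ {n} → N ℕ.≤ n → a n ≡ seq x n
  a≡x {n} n≥ = ℚ.p≥q⇒p⊔q≡p (subst (ℚ._≤ seq x n) (ℚ.+-identityˡ ε) (ε≤ n n≥))
  reciprocal : ∀ n → ∃[ r ] 0ℚ ℚ.< r × a n ℚ.* r ≡ 1ℚ
  reciprocal n = divide (a n) 1ℚ (ℚ.<-≤-trans ε>0 (ε≤a n)) 1ℚ>0
  r : ℕ → ℚ
  r n = proj₁ (reciprocal n)
  r>0 : ∀ n → 0ℚ ℚ.< r n
  r>0 n = proj₁ (proj₂ (reciprocal n))
  ar≡1 : ∀ n → a n ℚ.* r n ≡ 1ℚ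
  ar≡1 n = proj₂ (proj₂ (reciprocal n))
  inverse : ∀ n → N ℕ.≤ n → seq x n ℚ.* r n ℚ.- 1ℚ ≡ 0ℚ
  inverse n n≥ = cong (ℚ._- 1ℚ) (trans (cong (ℚ._* r n) (sym (a≡x n≥))) (ar≡1 n))
  1/ε : ∃[ K ] 0ℚ ℚ.< K × ε ℚ.* K ≡ 1ℚ
  1/ε = divide ε 1ℚ ε>0 1ℚ>0
  K : ℚ
  K = proj₁ 1/ε
  K>0 : 0ℚ ℚ.< K
  K>0 = proj₁ (proj₂ 1/ε)
  -- With a r = 1 and ε K = 1, the nonnegative product K r (a - ε) collapses to K - r.
  r≤K : ∀ n → r n ℚ.≤ K
  r≤K n = 0≤q-p⇒p≤q (subst (0ℚ ℚ.≤_) difference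
    (0≤*0≤ (0≤*0≤ (ℚ.<⇒≤ K>0) (ℚ.<⇒≤ (r>0 n))) (p≤q⇒0≤q-p (ε≤a n))))
    where
    expand : ∀ K r a ε → (K ℚ.* r) ℚ.* (a ℚ.- ε) ≡ K ℚ.* (a ℚ.* r) ℚ.- r ℚ.* (ε ℚ.* K)
    expand = solve 4 (λ K r a ε → (K :* r) :* (a :- ε) := K :* (a :* r) :- r :* (ε :* K)) refl
    difference : (K ℚ.* r n) ℚ.* (a n ℚ.- ε) ≡ K ℚ.- r n
    difference = trans (expand K (r n) (a n) ε) (cong₂ ℚ._-_
      (trans (cong (K ℚ.*_) (ar≡1 n)) (ℚ.*-identityʳ K))
      (trans (cong (r n ℚ.*_) (proj₂ (proj₂ 1/ε))) (ℚ.*-identityʳ (r n))))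
  ∣r∣≤K : ∀ n → ℚ.∣ r n ∣ ℚ.≤ K
  ∣r∣≤K n = subst (ℚ._≤ K) (sym (ℚ.0≤p⇒∣p∣≡p (ℚ.<⇒≤ (r>0 n)))) (r≤K n)
  -- The rule 1/p - 1/q = (q - p)/(pq): with reciprocals bounded by `K`, differences of `x` control
  -- differences of `r` up to the factor K².
  r-difference : ∀ {m n} → N ℕ.≤ m → N ℕ.≤ n →
                 r m ℚ.- r n ≡ (r m ℚ.* r n) ℚ.* (seq x n ℚ.- seq x m)
  r-difference {m} {n} m≥ n≥ = begin
    r m ℚ.- r n
      ≡⟨ cong₂ ℚ._-_ (ℚ.*-identityʳ (r m)) (ℚ.*-identityʳ (r n)) ⟨
    r m ℚ.* 1ℚ ℚ.- r n ℚ.* 1ℚ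
      ≡⟨ cong₂ (λ p q → r m ℚ.* p ℚ.- r n ℚ.* q) (ar≡1 n) (ar≡1 m) ⟨
    r m ℚ.* (a n ℚ.* r n) ℚ.- r n ℚ.* (a m ℚ.* r m)
      ≡⟨ collect (r m) (r n) (a m) (a n) ⟩
    (r m ℚ.* r n) ℚ.* (a n ℚ.- a m)
      ≡⟨ cong₂ (λ p q → (r m ℚ.* r n) ℚ.* (p ℚ.- q)) (a≡x n≥) (a≡x m≥) ⟩
    (r m ℚ.* r n) ℚ.* (seq x n ℚ.- seq x m) ∎
    where
    open ≡-Reasoning
    collect : ∀ p q a b → p ℚ.* (b ℚ.* q) ℚ.- q ℚ.* (a ℚ.* p) ≡ (p ℚ.* q) ℚ.* (b ℚ.- a)
    collect = solve 4 (λ p q a b → p :* (b :* q) :- q :* (a :* p) := (p :* q) :* (b :- a)) refl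
  r-cauchy : IsCauchy r
  r-cauchy η η>0
    with δ , δ>0 , KKδ≡η ← divide (K ℚ.* K) η
           (ℚ.positive⁻¹ _ {{ℚ.pos*pos⇒pos K {{ℚ.positive K>0}} K {{ℚ.positive K>0}}}}) η>0
    with M , close ← cauchy x δ δ>0
    = N ℕ.⊔ M , λ m n m≥ n≥ →
      subst₂ ℚ._≤_
        (cong ℚ.∣_∣ (sym (r-difference (ℕ.m⊔n≤o⇒m≤o N M m≥) (ℕ.m⊔n≤o⇒m≤o N M n≥)))) KKδ≡η
        (∣p*q∣≤ {r m ℚ.* r n} {seq x n ℚ.- seq x m} (∣p*q∣≤ {r m} {r n} (∣r∣≤K m) (∣r∣≤K n))
          (close n m (ℕ.m⊔n≤o⇒n≤o N M n≥) (ℕ.m⊔n≤o⇒n≤o N M m≥)))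

<⇒0<- : ∀ {x y} → x < y → 0ℝ < y - x
<⇒0<- {x} {y} (ε , ε>0 , h) = ε , ε>0 , eventually-map
  (λ {n} p → subst (ℚ._≤ seq y n ℚ.- seq x n) (lem (seq x n) ε) (ℚ.+-monoˡ-≤ (ℚ.- seq x n) p)) h
  where
  open +-*-Solver
  lem : ∀ x e → x ℚ.+ e ℚ.- x ≡ 0ℚ ℚ.+ e
  lem = solve 2 (λ x e → x :+ e :- x := con 0ℚ :+ e) refl

-- Here `g` is 1/(1 - θ). The fixed-point equation is what unfolds a partial sum by one term, and
-- nonnegativity later gives the remainder its sign.
geometric-sum : ∀ {θ} → θ < 1ℝ → ∃[ g ] g ≃ 1ℝ + θ * g × 0ℝ ≼ g
geometric-sum {θ} θ<1 = fromInverse (positive-inverse (<⇒0<- {θ} {1ℝ} θ<1))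
  where
  open +-*-Solver
  lem : ∀ t g → g ≡ (1ℚ ℚ.- t) ℚ.* g ℚ.+ t ℚ.* g
  lem = solve 2 (λ t g → g := (con 1ℚ :- t) :* g :+ t :* g) refl
  fromInverse : ∃[ g ] (1ℝ - θ) * g ≃ 1ℝ × 0ℝ ≼ g → ∃[ g ] g ≃ 1ℝ + θ * g × 0ℝ ≼ g
  fromInverse (g , inverse , 0≼g) = g ,
    ≃-trans (pointwise⇒≃ {y = (1ℝ - θ) * g + θ * g} λ n → lem (seq θ n) (seq g n))
      (+-cong inverse ≃-refl) ,
    0≼g

-- The Archimedean property and the decay of powers

toℚᵘ-× : ∀ n → ℚ.toℚᵘ (n ℚMult.× 1ℚ) ℚᵘ.≃ ℚᵘ.mkℚᵘ (+ n) 0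
toℚᵘ-× zero    = ℚᵘ.≃-refl
toℚᵘ-× (suc n) = ℚᵘ.≃-trans (ℚ.toℚᵘ-homo-+ 1ℚ (n ℚMult.× 1ℚ))
  (ℚᵘ.≃-trans (ℚᵘ.+-congʳ (ℚᵘ.mkℚᵘ (+ 1) 0) (toℚᵘ-× n)) (ℚᵘ.*≡* (lem (+ n))))
  where
  open ℤ-Solver
  lem : ∀ n → ((+ 1 ℤ.* + 1) ℤ.+ n ℤ.* + 1) ℤ.* + 1 ≡ (+ 1 ℤ.+ n) ℤ.* + 1
  lem = solve 1 (λ n → (con (+ 1) :* con (+ 1) :+ n :* con (+ 1)) :* con (+ 1)
                       := (con (+ 1) :+ n) :* con (+ 1)) refl

×-nonNeg : ∀ n {ε} → 0ℚ ℚ.≤ ε → 0ℚ ℚ.≤ n ℚMult.× ε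
×-nonNeg zero    0≤ε = ℚ.≤-refl
×-nonNeg (suc n) 0≤ε = ℚ.+-mono-≤ 0≤ε (×-nonNeg n 0≤ε)

×-monoˡ : ∀ {m n ε} → 0ℚ ℚ.≤ ε → m ℕ.≤ n → m ℚMult.× ε ℚ.≤ n ℚMult.× ε
×-monoˡ {n = n} 0≤ε ℕ.z≤n = ×-nonNeg n 0≤ε
×-monoˡ {ε = ε} 0≤ε (ℕ.s≤s m≤n) = ℚ.+-monoʳ-≤ ε (×-monoˡ 0≤ε m≤n)

×-*-assoc : ∀ n p q → p ℚ.* (n ℚMult.× q) ≡ n ℚMult.× (p ℚ.* q)
×-*-assoc zero    p q = ℚ.*-zeroʳ p
×-*-assoc (suc n) p q =
  trans (ℚ.*-distribˡ-+ p q _) (cong (p ℚ.* q ℚ.+_) (×-*-assoc n p q))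

-- A denominator is at least 1, so a nonnegative numerator bounds its fraction; a negative fraction
-- is bounded by 0.
p≤n×1 : ∀ p → ∃[ n ] p ℚ.≤ n ℚMult.× 1ℚ
p≤n×1 (mkℚ (+ n) _ _) = n , ℚ.toℚᵘ-cancel-≤ (ℚᵘ.≤-respʳ-≃ (ℚᵘ.≃-sym (toℚᵘ-× n))
  (ℚᵘ.*≤* (ℤ.*-monoˡ-≤-nonNeg (+ n) (ℤ.+≤+ (ℕ.s≤s ℕ.z≤n)))))
p≤n×1 p@(mkℚ -[1+ _ ] _ _) = 0 , ℚ.nonPositive⁻¹ p

archimedean : ∀ {ε} → 0ℚ ℚ.< ε → ∀ {B} → 0ℚ ℚ.< B → Eventually λ n → B ℚ.≤ n ℚMult.× ε
archimedean {ε} ε>0 {B} B>0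
  with t , _ , εt≡B ← divide ε B ε>0 B>0
  with N , t≤N ← p≤n×1 t
  = N , λ n n≥ → begin
    B                       ≡⟨ εt≡B ⟨
    ε ℚ.* t                 ≤⟨ ℚ.*-monoˡ-≤-nonNeg ε {{ℚ.nonNegative (ℚ.<⇒≤ ε>0)}} t≤N ⟩
    ε ℚ.* (N ℚMult.× 1ℚ)    ≡⟨ ×-*-assoc N ε 1ℚ ⟩
    N ℚMult.× (ε ℚ.* 1ℚ)    ≡⟨ cong (N ℚMult.×_) (ℚ.*-identityʳ ε) ⟩
    N ℚMult.× ε             ≤⟨ ×-monoˡ (ℚ.<⇒≤ ε>0) n≥ ⟩
    n ℚMult.× ε             ∎
  where open ℚ.≤-Reasoning

*-monoʳ-≼ : ∀ {x y z} → 0ℝ ≼ z → x ≼ y → x * z ≼ y * z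
*-monoʳ-≼ {x} {y} {z} 0≼z x≼y = begin
  x * z   ≈⟨ R.*-comm x z ⟩
  z * x   ≲⟨ *-monoˡ-≼ 0≼z x≼y ⟩
  z * y   ≈⟨ R.*-comm z y ⟩
  y * z   ∎
  where open ≼-Reasoning

0≼^ : ∀ {θ} → 0ℝ ≼ θ → ∀ n → 0ℝ ≼ θ ^ n
0≼^ 0≼θ zero    = fromℚ-mono (ℚ.<⇒≤ 1ℚ>0)
0≼^ 0≼θ (suc n) = 0≼*0≼ 0≼θ (0≼^ 0≼θ n)

-- A division-free form of θⁿ ≤ 1/(1 + nε). The induction rests on (1 - ε)(1 + (n+1)ε) ≤ 1 + nε,
-- where the two sides differ by ε(nε + ε).
bernoulli : ∀ {θ ε} → 0ℝ ≼ θ → 0ℚ ℚ.≤ ε → θ ≼ fromℚ (1ℚ ℚ.- ε) →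
            ∀ n → θ ^ n * fromℚ (1ℚ ℚ.+ n ℚMult.× ε) ≼ 1ℝ
bernoulli 0≼θ 0≤ε θ≼ zero = ≃⇒≼ (pointwise⇒≃ λ _ → refl)
bernoulli {θ} {ε} 0≼θ 0≤ε θ≼ (suc n) = begin
  (θ * θ ^ n) * fromℚ b′                  ≈⟨ R.*-congʳ {fromℚ b′} (R.*-comm θ (θ ^ n)) ⟩
  (θ ^ n * θ) * fromℚ b′                  ≈⟨ R.*-assoc (θ ^ n) θ (fromℚ b′) ⟩
  θ ^ n * (θ * fromℚ b′)                  ≲⟨ *-monoˡ-≼ (0≼^ 0≼θ n) (*-monoʳ-≼ (fromℚ-mono 0≤b′) θ≼) ⟩
  θ ^ n * (fromℚ (1ℚ ℚ.- ε) * fromℚ b′)   ≲⟨ *-monoˡ-≼ (0≼^ 0≼θ n) (eventually-≤⇒≼ (always λ _ → step)) ⟩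
  θ ^ n * fromℚ (1ℚ ℚ.+ n ℚMult.× ε)      ≲⟨ bernoulli 0≼θ 0≤ε θ≼ n ⟩
  1ℝ                                      ∎
  where
  open ≼-Reasoning
  open +-*-Solver
  b′ : ℚ
  b′ = 1ℚ ℚ.+ suc n ℚMult.× ε
  0≤b′ : 0ℚ ℚ.≤ b′
  0≤b′ = ℚ.+-mono-≤ (ℚ.<⇒≤ 1ℚ>0) (×-nonNeg (suc n) 0≤ε)
  lem : ∀ m e → (1ℚ ℚ.+ m) ℚ.- (1ℚ ℚ.- e) ℚ.* (1ℚ ℚ.+ (e ℚ.+ m)) ≡ e ℚ.* (m ℚ.+ e)
  lem = solve 2 (λ m e → (con 1ℚ :+ m) :- (con 1ℚ :- e) :* (con 1ℚ :+ (e :+ m)) := e :* (m :+ e)) refl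
  step : (1ℚ ℚ.- ε) ℚ.* b′ ℚ.≤ 1ℚ ℚ.+ n ℚMult.× ε
  step = 0≤q-p⇒p≤q (subst (0ℚ ℚ.≤_) (sym (lem (n ℚMult.× ε) ε))
    (0≤*0≤ 0≤ε (ℚ.+-mono-≤ (×-nonNeg n 0≤ε) 0≤ε)))

geometric-decay : ∀ {θ} → 0ℝ ≼ θ → θ < 1ℝ → ∀ M η → 0ℚ ℚ.< η →
                  Eventually λ n → θ ^ n * M ≼ fromℚ η
geometric-decay {θ} 0≼θ (ε , ε>0 , h) M η η>0
  with B , B>0 , M≼B ← fromℚ-upperBound M
  -- K is B/η: once nε ≥ K, also B ≤ (1 + nε)η, and Bernoulli absorbs the factor 1 + nε into
  -- `θ ^ n`.
  with K , K>0 , ηK≡B ← divide η B η>0 B>0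
  = eventually-map (λ {n} → decay n) (archimedean ε>0 K>0)
  where
  open +-*-Solver
  lem : ∀ t e → t ≡ t ℚ.+ e ℚ.- e
  lem = solve 2 (λ t e → t := t :+ e :- e) refl
  θ≼1-ε : θ ≼ fromℚ (1ℚ ℚ.- ε)
  θ≼1-ε = eventually-≤⇒≼ (eventually-map
    (λ {n} p → subst (ℚ._≤ 1ℚ ℚ.- ε) (sym (lem (seq θ n) ε)) (ℚ.+-monoˡ-≤ (ℚ.- ε) p)) h)
  decay : ∀ n → K ℚ.≤ n ℚMult.× ε → θ ^ n * M ≼ fromℚ η
  decay n K≤nε = begin
    θ ^ n * M                     ≲⟨ *-monoˡ-≼ (0≼^ 0≼θ n) M≼B ⟩
    θ ^ n * fromℚ B               ≲⟨ *-monoˡ-≼ (0≼^ 0≼θ n) (fromℚ-mono B≤bη) ⟩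
    θ ^ n * (fromℚ (b ℚ.* η))     ≈⟨ pointwise⇒≃ (λ k → sym (ℚ.*-assoc (seq (θ ^ n) k) b η)) ⟩
    (θ ^ n * fromℚ b) * fromℚ η   ≲⟨ *-monoʳ-≼ (fromℚ-mono (ℚ.<⇒≤ η>0)) (bernoulli 0≼θ (ℚ.<⇒≤ ε>0) θ≼1-ε n) ⟩
    1ℝ * fromℚ η                  ≈⟨ R.*-identityˡ (fromℚ η) ⟩
    fromℚ η                       ∎
    where
    open ≼-Reasoning
    b : ℚ
    b = 1ℚ ℚ.+ n ℚMult.× ε
    B≤bη : B ℚ.≤ b ℚ.* η
    B≤bη = subst₂ ℚ._≤_ ηK≡B (ℚ.*-comm η b)
      (ℚ.*-monoˡ-≤-nonNeg η {{ℚ.nonNegative (ℚ.<⇒≤ η>0)}}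
        (ℚ.≤-trans K≤nε (subst (ℚ._≤ b) (ℚ.+-identityˡ (n ℚMult.× ε)) (ℚ.+-monoˡ-≤ (n ℚMult.× ε) (ℚ.<⇒≤ 1ℚ>0)))))

-- Limits of real sequences

∣-∣-≼-intro : ∀ {x y z} → x ≼ y + z → y ≼ x + z → ∣ x - y ∣ ≼ z
∣-∣-≼-intro {x} {y} {z} (mk≼ h) (mk≼ k) = ∣-∣-≼
  (mk≼ (limNonNeg-cong (λ n → lem (seq x n) (seq y n) (seq z n)) h))
  (mk≼ (limNonNeg-cong (λ n → lem′ (seq x n) (seq y n) (seq z n)) k))
  where
  open +-*-Solver
  lem : ∀ x y z → (y ℚ.+ z) ℚ.- x ≡ z ℚ.- (x ℚ.- y)
  lem = solve 3 (λ x y z → (y :+ z) :- x := z :- (x :- y)) refl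
  lem′ : ∀ x y z → (x ℚ.+ z) ℚ.- y ≡ z ℚ.- (ℚ.- (x ℚ.- y))
  lem′ = solve 3 (λ x y z → (x :+ z) :- y := z :- (:- (x :- y))) refl

∣-∣-≼-elim : ∀ {x y z} → ∣ x - y ∣ ≼ z → x ≼ y + z × y ≼ x + z
∣-∣-≼-elim {x} {y} {z} h = (begin
    x                  ≈⟨ pointwise⇒≃ (λ n → lem (seq x n) (seq y n)) ⟩
    y + (x - y)        ≲⟨ +-mono-≼ ≼-refl (≼-trans (x≼∣x∣ (x - y)) h) ⟩
    y + z              ∎) , (begin
    y                  ≈⟨ pointwise⇒≃ (λ n → lem′ (seq x n) (seq y n)) ⟩
    x + - (x - y)      ≲⟨ +-mono-≼ ≼-refl (≼-trans (-x≼∣x∣ (x - y)) h) ⟩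
    x + z              ∎)
  where
  open ≼-Reasoning
  open +-*-Solver
  lem : ∀ x y → x ≡ y ℚ.+ (x ℚ.- y)
  lem = solve 2 (λ x y → x := y :+ (x :- y)) refl
  lem′ : ∀ x y → y ≡ x ℚ.+ (ℚ.- (x ℚ.- y))
  lem′ = solve 2 (λ x y → y := x :+ (:- (x :- y))) refl

squeeze : ∀ {s r v z} → s + r ≃ v → 0ℝ ≼ r → r ≼ z → ∣ s - v ∣ ≼ z
squeeze {s} {r} {v} {z} s+r≃v 0≼r r≼z = ∣-∣-≼-intro {s} {v} {z}
  (begin
    s        ≈⟨ R.+-identityʳ s ⟨
    s + 0ℝ   ≲⟨ +-mono-≼ ≼-refl 0≼r ⟩
    s + r    ≈⟨ s+r≃v ⟩
    v        ≈⟨ R.+-identityʳ v ⟨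
    v + 0ℝ   ≲⟨ +-mono-≼ ≼-refl (≼-trans 0≼r r≼z) ⟩
    v + z    ∎)
  (begin
    v        ≈⟨ s+r≃v ⟨
    s + r    ≲⟨ +-mono-≼ ≼-refl r≼z ⟩
    s + z    ∎)
  where open ≼-Reasoning

-- The error is known exactly, as a nonnegative remainder. The equation is required only eventually
-- because the empty partial cost lacks the term of time 0, which does not follow the geometric
-- pattern.
converges : ∀ {s v} (r : ℕ → ℝ) →
            Eventually (λ n → s n + r n ≃ v) → (∀ n → 0ℝ ≼ r n) →
            (∀ η → 0ℚ ℚ.< η → Eventually λ n → r n ≼ fromℚ η) → Converges s v
converges {s} {v} r s+r≃v 0≼r r→0 ε ε>0 =
  let η , η>0 , gap = ≤-fromℚ-gap {ε} ε>0
  in eventually-zip (λ {n} eq r≼η → gap ∣ s n - v ∣ (squeeze eq (0≼r n) r≼η)) s+r≃v (r→0 η η>0)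

fromℚ-positive : ∀ {ε} → 0ℚ ℚ.< ε → 0ℝ < fromℚ ε
fromℚ-positive {ε} ε>0 = ε , ε>0 , always λ _ → ℚ.≤-reflexive (ℚ.+-identityˡ ε)

converges-mono : ∀ {s t v w} → (∀ n → s n ≼ t n) → Converges s v → Converges t w → v ≼ w
converges-mono {s} {t} {v} {w} s≼t s→v t→w = ≼-fromℚ-closed bound
  where
  open ≼-Reasoning
  bound : ∀ η → 0ℚ ℚ.< η → v ≼ w + fromℚ η
  bound η η>0
    with M , hM ← s→v (fromℚ (½ ℚ.* η)) (fromℚ-positive (half>0 η>0))
    with N , hN ← t→w (fromℚ (½ ℚ.* η)) (fromℚ-positive (half>0 η>0)) = begin
      v
        ≲⟨ proj₂ (∣-∣-≼-elim {s n} {v} (<⇒≼ (hM n (ℕ.m≤m⊔n M N)))) ⟩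
      s n + fromℚ (½ ℚ.* η)
        ≲⟨ +-mono-≼ (s≼t n) ≼-refl ⟩
      t n + fromℚ (½ ℚ.* η)
        ≲⟨ +-mono-≼ (proj₁ (∣-∣-≼-elim {t n} {w} (<⇒≼ (hN n (ℕ.m≤n⊔m M N))))) ≼-refl ⟩
      (w + fromℚ (½ ℚ.* η)) + fromℚ (½ ℚ.* η)
        ≈⟨ pointwise⇒≃ (λ k → trans (ℚ.+-assoc (seq w k) _ _) (cong (seq w k ℚ.+_) (half+half η))) ⟩
      w + fromℚ η ∎
    where
    n : ℕ
    n = M ℕ.⊔ N

-- Balanced states as sums of pairs

sumℕ≡0⇒≡0 : ∀ {n} (f : Fin n → ℕ) → sumℕ f ≡ 0 → ∀ i → f i ≡ 0
sumℕ≡0⇒≡0 f eq zero    = ℕ.m+n≡0⇒m≡0 (f zero) eq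
sumℕ≡0⇒≡0 f eq (suc i) = sumℕ≡0⇒≡0 (f ∘ suc) (ℕ.m+n≡0⇒n≡0 (f zero) eq) i

sumℕ>0⇒∃>0 : ∀ {n} (f : Fin n → ℕ) → 0 ℕ.< sumℕ f → ∃[ i ] 0 ℕ.< f i
sumℕ>0⇒∃>0 {suc n} f pos with f zero in eq
... | suc _ = zero , subst (0 ℕ.<_) (sym eq) ℕ.z<s
... | zero  with i , fi>0 ← sumℕ>0⇒∃>0 (f ∘ suc) pos = suc i , fi>0

module SumsOfPairs (G : BipartiteGraph) where

  open Matching G

  sumℕ-δ : ∀ {n} (k : Fin n) → sumℕ (δ k) ≡ 1
  sumℕ-δ {suc n} zero = cong suc (sum-zero {n} λ _ → refl)
  sumℕ-δ (suc k) = sumℕ-δ k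

  δ≤ : ∀ {n} {f : Fin n → ℕ} {k} → 0 ℕ.< f k → ∀ l → δ k l ℕ.≤ f l
  δ≤ {k = k} fk>0 l with k Fin.≟ l
  ... | yes refl = fk>0
  ... | no _     = ℕ.z≤n

  node-elim : (P : Node → Set) → (∀ i → P (d i)) → (∀ j → P (s j)) → ∀ k → P k
  node-elim P Pd Ps k with splitAt nD k | Fin.join-splitAt nD nS k
  ... | inj₁ i | refl = Pd i
  ... | inj₂ j | refl = Ps j

  lookup-ext : ∀ {n} {x y : Vec ℕ n} → (∀ k → lookup x k ≡ lookup y k) → x ≡ y
  lookup-ext h = Pointwise.Pointwise-≡⇒≡ (Pointwise.ext h)

  sumℕ-lookup-⊕ : ∀ {n} (x y : Vec ℕ (nD ℕ.+ nS)) (g : Fin n → Node) →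
    sumℕ (λ i → lookup (x ⊕ y) (g i)) ≡ sumℕ (λ i → lookup x (g i)) ℕ.+ sumℕ (λ i → lookup y (g i))
  sumℕ-lookup-⊕ x y g = trans (Σℕ.sum-cong-≗ λ i → lookup-⊕ x y (g i))
    (Σℕ.∑-distrib-+ (λ i → lookup x (g i)) (λ i → lookup y (g i)))

  ⊕-balanced⁻ : ∀ {x y} → IsBalanced (x ⊕ y) → IsBalanced y → IsBalanced x
  ⊕-balanced⁻ {x} {y} h hy = ℕ.+-cancelʳ-≡ (sumℕ λ i → lookup y (d i)) _ _ (begin
    sumℕ (λ i → lookup x (d i)) ℕ.+ sumℕ (λ i → lookup y (d i))   ≡⟨ sumℕ-lookup-⊕ x y d ⟨
    sumℕ (λ i → lookup (x ⊕ y) (d i))                             ≡⟨ h ⟩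
    sumℕ (λ j → lookup (x ⊕ y) (s j))                             ≡⟨ sumℕ-lookup-⊕ x y s ⟩
    sumℕ (λ j → lookup x (s j)) ℕ.+ sumℕ (λ j → lookup y (s j))   ≡⟨ cong (_ ℕ.+_) hy ⟨
    sumℕ (λ j → lookup x (s j)) ℕ.+ sumℕ (λ i → lookup y (d i))   ∎)
    where open ≡-Reasoning

  -- A decomposition serves twice: counting its pairs gives a matching, and adding them one by one
  -- gives a chain of states along which the cost can be compared. It is not unique, but any one
  -- will do.
  data SumOfPairs : Vec ℕ (nD ℕ.+ nS) → Set where
    empty : SumOfPairs (replicate _ 0)
    _▷_   : ∀ {x} → SumOfPairs x → ∀ a → SumOfPairs (x ⊕ eₐ a)

  sumOfPairs⇒balanced : ∀ {x} → SumOfPairs x → IsBalanced x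
  sumOfPairs⇒balanced empty =
    trans (sum-zero λ i → Vec.lookup-replicate (d i) 0)
          (sym (sum-zero λ j → Vec.lookup-replicate (s j) 0))
  sumOfPairs⇒balanced (_▷_ {x} p a) = ⊕-balanced {x} {eₐ a} (sumOfPairs⇒balanced p) (eₐ-balanced a)

  -- Induction on the total demand. If it is positive, balance makes the total supply positive too,
  -- so some demand node and some supply node are both occupied and a pair can be split off. If it
  -- is zero, balance empties the supply side as well.
  balanced⇒sumOfPairs : ∀ x → IsBalanced x → SumOfPairs x
  balanced⇒sumOfPairs x = go _ x refl
    where
    go : ∀ m x → sumℕ (λ i → lookup x (d i)) ≡ m → IsBalanced x → SumOfPairs x
    go zero x eq bal = subst SumOfPairs (lookup-ext λ k → trans (Vec.lookup-replicate k 0) (sym (x≡0 k))) empty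
      where
      x≡0 : ∀ k → lookup x k ≡ 0
      x≡0 = node-elim _ (sumℕ≡0⇒≡0 _ eq) (sumℕ≡0⇒≡0 _ (trans (sym bal) eq))
    go (suc m) x eq bal = subst SumOfPairs y⊕a≡x (go m y y-total y-bal ▷ a)
      where
      i,pos : ∃[ i ] 0 ℕ.< lookup x (d i)
      i,pos = sumℕ>0⇒∃>0 (λ i → lookup x (d i)) (subst (0 ℕ.<_) (sym eq) ℕ.z<s)
      j,pos : ∃[ j ] 0 ℕ.< lookup x (s j)
      j,pos = sumℕ>0⇒∃>0 (λ j → lookup x (s j)) (subst (0 ℕ.<_) (trans (sym eq) bal) ℕ.z<s)
      i : Fin nD
      i = proj₁ i,pos
      j : Fin nS
      j = proj₁ j,pos
      a : 𝒜
      a = i , j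
      y : Vec ℕ (nD ℕ.+ nS)
      y = zipWith _∸_ x (eₐ a)
      eₐ≤x : ∀ k → lookup (eₐ a) k ℕ.≤ lookup x k
      eₐ≤x = node-elim _
        (λ i′ → subst (ℕ._≤ lookup x (d i′)) (sym (lookup-eₐ-d i j i′)) (δ≤ {f = λ i → lookup x (d i)} (proj₂ i,pos) i′))
        (λ j′ → subst (ℕ._≤ lookup x (s j′)) (sym (lookup-eₐ-s i j j′)) (δ≤ {f = λ j → lookup x (s j)} (proj₂ j,pos) j′))
      y⊕a≡x : y ⊕ eₐ a ≡ x
      y⊕a≡x = lookup-ext λ k → trans (lookup-⊕ y (eₐ a) k)
        (trans (cong (ℕ._+ lookup (eₐ a) k) (Vec.lookup-zipWith _∸_ k x (eₐ a))) (ℕ.m∸n+n≡m (eₐ≤x k)))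
      y-bal : IsBalanced y
      y-bal = ⊕-balanced⁻ {y} {eₐ a} (subst IsBalanced (sym y⊕a≡x) bal) (eₐ-balanced a)
      y-total : sumℕ (λ i → lookup y (d i)) ≡ m
      y-total = ℕ.+-cancelʳ-≡ 1 _ m (begin
        sumℕ (λ i → lookup y (d i)) ℕ.+ 1
          ≡⟨ cong (sumℕ (λ i → lookup y (d i)) ℕ.+_) (trans (Σℕ.sum-cong-≗ (lookup-eₐ-d i j)) (sumℕ-δ i)) ⟨
        sumℕ (λ i → lookup y (d i)) ℕ.+ sumℕ (λ i → lookup (eₐ a) (d i))
          ≡⟨ sumℕ-lookup-⊕ y (eₐ a) d ⟨
        sumℕ (λ i → lookup (y ⊕ eₐ a) (d i))
          ≡⟨ cong (λ z → sumℕ λ i → lookup z (d i)) y⊕a≡x ⟩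
        sumℕ (λ i → lookup x (d i))
          ≡⟨ eq ⟩
        suc m
          ≡⟨ ℕ.+-comm m 1 ⟨
        m ℕ.+ 1 ∎)
        where open ≡-Reasoning

  multiplicity : ∀ {x} → SumOfPairs x → Fin nD → Fin nS → ℕ
  multiplicity empty         i j = 0
  multiplicity (p ▷ (a , b)) i j = multiplicity p i j ℕ.+ δ a i ℕ.* δ b j

  private module ℕSum = SemiringSum ℕ.+-*-semiring

  sumℕ-multiplicity-d : ∀ {x} (p : SumOfPairs x) i → sumℕ (multiplicity p i) ≡ lookup x (d i)
  sumℕ-multiplicity-d empty i = trans (sum-zero {nS} λ _ → refl) (sym (Vec.lookup-replicate (d i) 0))
  sumℕ-multiplicity-d (_▷_ {x} p (a , b)) i = begin
    sumℕ (λ j → multiplicity p i j ℕ.+ δ a i ℕ.* δ b j)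
      ≡⟨ Σℕ.∑-distrib-+ (multiplicity p i) (λ j → δ a i ℕ.* δ b j) ⟩
    sumℕ (multiplicity p i) ℕ.+ sumℕ (λ j → δ a i ℕ.* δ b j)
      ≡⟨ cong₂ ℕ._+_ (sumℕ-multiplicity-d p i) (sym (ℕSum.*-distribˡ-sum (δ a i) (δ b))) ⟩
    lookup x (d i) ℕ.+ δ a i ℕ.* sumℕ (δ b)
      ≡⟨ cong (lookup x (d i) ℕ.+_) (trans (cong (δ a i ℕ.*_) (sumℕ-δ b)) (ℕ.*-identityʳ (δ a i))) ⟩
    lookup x (d i) ℕ.+ δ a i
      ≡⟨ cong (lookup x (d i) ℕ.+_) (lookup-eₐ-d a b i) ⟨
    lookup x (d i) ℕ.+ lookup (eₐ (a , b)) (d i)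
      ≡⟨ lookup-⊕ x (eₐ (a , b)) (d i) ⟨
    lookup (x ⊕ eₐ (a , b)) (d i) ∎
    where open ≡-Reasoning

  sumℕ-multiplicity-s : ∀ {x} (p : SumOfPairs x) j → sumℕ (λ i → multiplicity p i j) ≡ lookup x (s j)
  sumℕ-multiplicity-s empty j = trans (sum-zero {nD} λ _ → refl) (sym (Vec.lookup-replicate (s j) 0))
  sumℕ-multiplicity-s (_▷_ {x} p (a , b)) j = begin
    sumℕ (λ i → multiplicity p i j ℕ.+ δ a i ℕ.* δ b j)
      ≡⟨ Σℕ.∑-distrib-+ (λ i → multiplicity p i j) (λ i → δ a i ℕ.* δ b j) ⟩
    sumℕ (λ i → multiplicity p i j) ℕ.+ sumℕ (λ i → δ a i ℕ.* δ b j)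
      ≡⟨ cong₂ ℕ._+_ (sumℕ-multiplicity-s p j) (sym (ℕSum.*-distribʳ-sum (δ b j) (δ a))) ⟩
    lookup x (s j) ℕ.+ sumℕ (δ a) ℕ.* δ b j
      ≡⟨ cong (lookup x (s j) ℕ.+_) (trans (cong (ℕ._* δ b j) (sumℕ-δ a)) (ℕ.*-identityˡ (δ b j))) ⟩
    lookup x (s j) ℕ.+ δ b j
      ≡⟨ cong (lookup x (s j) ℕ.+_) (lookup-eₐ-s a b j) ⟨
    lookup x (s j) ℕ.+ lookup (eₐ (a , b)) (s j)
      ≡⟨ lookup-⊕ x (eₐ (a , b)) (s j) ⟨
    lookup (x ⊕ eₐ (a , b)) (s j) ∎
    where open ≡-Reasoning

  module _ (complete : IsComplete G) where

    ν-complete : ∀ μ i j → ν μ i j ≡ μ i j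
    ν-complete μ i j =
      cong (λ b → if b then μ i j else 0) (dec-true (edge? i j) (complete i j))

    -- Completeness turns every pair of a decomposition into an edge, and the multiplicities have
    -- the entries of `x` as row and column sums, so all capacity bounds are tight.
    self-admissible : ∀ x → IsBalanced x → IsAdmissible x x
    self-admissible x bal = record
      { μ           = μ
      ; isMatching  = lookup-ext (node-elim _
          -- `refl` takes the matched vector to be the edge sum itself, which is then compared with
          -- `x` entry by entry.
          (λ i → sym (trans (lookup-u-d μ refl i) (row i)))
          (λ j → sym (trans (lookup-u-s μ refl j) (column j))))
      ; demandBound = λ i → ℕ.≤-reflexive (trans (sumOver-𝒮 μ i) (row i))
      ; supplyBound = λ j → ℕ.≤-reflexive (trans (sumOver-𝒟 μ j) (column j))
      }
      where
      p : SumOfPairs x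
      p = balanced⇒sumOfPairs x bal
      μ : Fin nD → Fin nS → ℕ
      μ = multiplicity p
      row : ∀ i → sumℕ (ν μ i) ≡ lookup x (d i)
      row i = trans (Σℕ.sum-cong-≗ (ν-complete μ i)) (sumℕ-multiplicity-d p i)
      column : ∀ j → sumℕ (λ i → ν μ i j) ≡ lookup x (s j)
      column j = trans (Σℕ.sum-cong-≗ λ i → ν-complete μ i j) (sumℕ-multiplicity-s p j)

    -- This keeps the optimality claim, which ranges over all such rules, from being vacuous.
    matchEverything : ∃ (Dynamics.MatchesEverything G)
    matchEverything =
      (λ (x , bal) → x , self-admissible x bal) ,
      λ (x , _) → lookup-ext λ k →
        trans (Vec.lookup-zipWith _∸_ k x x)
          (trans (ℕ.n∸n≡0 (lookup x k)) (sym (Vec.lookup-replicate k 0)))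

-- Finite sums of reals and sums over arrival paths

sumℝ-mono : ∀ {n} {f g : Fin n → ℝ} → (∀ i → f i ≼ g i) → sumℝ f ≼ sumℝ g
sumℝ-mono {zero}  f≼g = ≼-refl
sumℝ-mono {suc n} f≼g = +-mono-≼ (f≼g zero) (sumℝ-mono (λ i → f≼g (suc i)))

sumℝ-nonNeg : ∀ {n} {f : Fin n → ℝ} → (∀ i → 0ℝ ≼ f i) → 0ℝ ≼ sumℝ f
sumℝ-nonNeg {n} {f} 0≼f = ≼-trans (≃⇒≼ (≃-sym (R-Sum.sum-replicate-zero n))) (sumℝ-mono 0≼f)

sumℝ-cong : ∀ {n} {f g : Fin n → ℝ} → (∀ i → f i ≃ g i) → sumℝ f ≃ sumℝ g
sumℝ-cong = R-Sum.sum-cong-≋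

*-distribˡ-sumℝ : ∀ {n} x (f : Fin n → ℝ) → sumℝ (λ i → x * f i) ≃ x * sumℝ f
*-distribˡ-sumℝ x f = ≃-sym (R-Sum.*-distribˡ-sum x f)

-- The hypothesis makes `t` the whole series θx + θ²x + ..., whose tail beyond N terms is a copy of
-- it scaled by `θ ^ N`.
geometric-partialSum : ∀ {θ x t} → t ≃ θ * x + θ * t → ∀ N →
  sumℝ {N} (λ n → θ ^ suc (toℕ n) * x) + θ ^ N * t ≃ t
geometric-partialSum {θ} {x} {t} t≃ zero =
  ≃-trans (R.+-identityˡ (1ℝ * t)) (R.*-identityˡ t)
geometric-partialSum {θ} {x} {t} t≃ (suc N) = begin
  ((θ * 1ℝ) * x + sumℝ {N} (λ n → (θ * θ ^ suc (toℕ n)) * x)) + (θ * θ ^ N) * t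
    ≈⟨ +-cong (+-cong ≃-refl (sumℝ-cong {N} λ n → R.*-assoc θ (θ ^ suc (toℕ n)) x)) ≃-refl ⟩
  ((θ * 1ℝ) * x + sumℝ {N} (λ n → θ * (θ ^ suc (toℕ n) * x))) + (θ * θ ^ N) * t
    ≈⟨ +-cong (+-cong ≃-refl (*-distribˡ-sumℝ {N} θ λ n → θ ^ suc (toℕ n) * x)) ≃-refl ⟩
  ((θ * 1ℝ) * x + θ * S) + (θ * θ ^ N) * t
    ≈⟨ pointwise⇒≃ (λ n → lem (seq θ n) (seq x n) (seq S n) (seq (θ ^ N) n) (seq t n)) ⟩
  θ * x + θ * (S + θ ^ N * t)
    ≈⟨ +-cong ≃-refl (*-cong ≃-refl (geometric-partialSum t≃ N)) ⟩
  θ * x + θ * t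
    ≈⟨ t≃ ⟨
  t ∎
  where
  open SetoidReasoning R.setoid
  open +-*-Solver
  S : ℝ
  S = sumℝ {N} λ n → θ ^ suc (toℕ n) * x
  lem : ∀ θ x S p t → ((θ ℚ.* 1ℚ) ℚ.* x ℚ.+ θ ℚ.* S) ℚ.+ (θ ℚ.* p) ℚ.* t
                      ≡ θ ℚ.* x ℚ.+ θ ℚ.* (S ℚ.+ p ℚ.* t)
  lem = solve 5 (λ θ x S p t → ((θ :* con 1ℚ) :* x :+ θ :* S) :+ (θ :* p) :* t
                               := θ :* x :+ θ :* (S :+ p :* t)) refl

module PathSums (G : BipartiteGraph) where

  open Matching G
  open Dynamics G

  sumPaths-cong : ∀ n {f g : Vec 𝒜 n → ℝ} → (∀ ω → f ω ≃ g ω) → sumPaths n f ≃ sumPaths n g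
  sumPaths-cong zero    f≃g = f≃g []
  sumPaths-cong (suc n) f≃g =
    sumℝ-cong λ i → sumℝ-cong λ j → sumPaths-cong n λ ω → f≃g ((i , j) ∷ ω)

  sumPaths-mono : ∀ n {f g : Vec 𝒜 n → ℝ} → (∀ ω → f ω ≼ g ω) → sumPaths n f ≼ sumPaths n g
  sumPaths-mono zero    f≼g = f≼g []
  sumPaths-mono (suc n) f≼g =
    sumℝ-mono λ i → sumℝ-mono λ j → sumPaths-mono n λ ω → f≼g ((i , j) ∷ ω)

  *-distribˡ-sumPaths : ∀ n x (f : Vec 𝒜 n → ℝ) → sumPaths n (λ ω → x * f ω) ≃ x * sumPaths n f
  *-distribˡ-sumPaths zero    x f = ≃-refl
  *-distribˡ-sumPaths (suc n) x f = ≃-trans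
    (sumℝ-cong λ i → ≃-trans
      (sumℝ-cong λ j → *-distribˡ-sumPaths n x λ ω → f ((i , j) ∷ ω))
      (*-distribˡ-sumℝ x λ j → sumPaths n λ ω → f ((i , j) ∷ ω)))
    (*-distribˡ-sumℝ x λ i → sumℝ λ j → sumPaths n λ ω → f ((i , j) ∷ ω))

-- Comparison of policies on a complete graph

module CompleteGraph {G : BipartiteGraph} (complete : IsComplete G)
                     (A : ArrivalLaw G) (C : LinearCost G) where

  open Matching G
  open ArrivalLaw A
  open LinearCost C
  open DiscountedProblem A C
  open SumsOfPairs G
  open PathSums G

  -- `cost` reads only the vector of a state. On bare vectors an equality can be transported without
  -- comparing proofs of balance.
  vecCost : Vec ℕ (nD ℕ.+ nS) → ℝ
  vecCost x = sumℝ λ k → lookup x k · coeff k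

  -- The zero summand makes this literally the cost of the empty state after the arrival `a`, the
  -- form that matching everything produces.
  pairCost : 𝒜 → ℝ
  pairCost a = vecCost (replicate _ 0 ⊕ eₐ a)

  pairCost-nonNeg : ∀ a → 0ℝ ≼ pairCost a
  pairCost-nonNeg a = ≤⇒≼ (nonNegative ((replicate _ 0 , sumOfPairs⇒balanced empty) ⊞ a))

  ⊕-swap : ∀ x y z → (x ⊕ y) ⊕ z ≡ (x ⊕ z) ⊕ y
  ⊕-swap x y z = trans (Vec.zipWith-assoc ℕ.+-assoc x y z)
    (trans (cong (x ⊕_) (Vec.zipWith-comm ℕ.+-comm y z)) (sym (Vec.zipWith-assoc ℕ.+-assoc x z y)))

  -- Cost monotonicity adds an edge last, to a state already containing `a`, whereas in the goal `a`
  -- comes last; hence the swap.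
  pairCost≼ : ∀ {x} → SumOfPairs x → ∀ a → pairCost a ≼ vecCost (x ⊕ eₐ a)
  pairCost≼ empty a = ≼-refl
  pairCost≼ (_▷_ {x} p (i , j)) a = begin
    pairCost a                            ≲⟨ pairCost≼ p a ⟩
    vecCost (x ⊕ eₐ a)                    ≲⟨ ≤⇒≼ (nonDecreasing (x⊕a , sumOfPairs⇒balanced (p ▷ a)) i j (complete i j)) ⟩
    vecCost ((x ⊕ eₐ a) ⊕ eₐ (i , j))     ≡⟨ cong vecCost (⊕-swap x (eₐ a) (eₐ (i , j))) ⟩
    vecCost ((x ⊕ eₐ (i , j)) ⊕ eₐ a)     ∎
    where
    open ≼-Reasoning
    x⊕a : Vec ℕ (nD ℕ.+ nS)
    x⊕a = x ⊕ eₐ a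

  ℙ-nonNeg : ∀ {n} (ω : Vec 𝒜 n) → 0ℝ ≼ ℙ ω
  ℙ-nonNeg []            = fromℚ-mono (ℚ.<⇒≤ 1ℚ>0)
  ℙ-nonNeg ((i , j) ∷ ω) = 0≼*0≼ (<⇒≼ (positive i j)) (ℙ-nonNeg ω)

  𝔼-mono : ∀ n {f g : Vec 𝒜 n → ℝ} → (∀ ω → f ω ≼ g ω) → 𝔼 n f ≼ 𝔼 n g
  𝔼-mono n f≼g = sumPaths-mono n λ ω → *-monoˡ-≼ (ℙ-nonNeg ω) (f≼g ω)

  sum-αβ : sumℝ (λ i → sumℝ λ j → α i * β j) ≃ 1ℝ
  sum-αβ = ≃-trans
    (sumℝ-cong λ i → ≃-trans (*-distribˡ-sumℝ (α i) β)
      (≃-trans (*-cong ≃-refl (≈⇒≃ sum-β)) (R.*-identityʳ (α i))))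
    (≈⇒≃ sum-α)

  sumPaths-ℙ : ∀ n → sumPaths n ℙ ≃ 1ℝ
  sumPaths-ℙ zero    = ≃-refl
  sumPaths-ℙ (suc n) = ≃-trans
    (sumℝ-cong λ i → sumℝ-cong λ j → ≃-trans
      (*-distribˡ-sumPaths n (α i * β j) ℙ)
      (≃-trans (*-cong ≃-refl (sumPaths-ℙ n)) (R.*-identityʳ (α i * β j))))
    sum-αβ

  -- Paths list the latest arrival first, so its probability factors out at the head, and the
  -- probabilities of the earlier arrivals sum to 1.
  𝔼-latest : ∀ n (f : Vec 𝒜 (suc n) → ℝ) (h : 𝒜 → ℝ) → (∀ a ω → f (a ∷ ω) ≡ h a) →
             𝔼 (suc n) f ≃ sumℝ λ i → sumℝ λ j → (α i * β j) * h (i , j)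
  𝔼-latest n f h f≡h = sumℝ-cong λ i → sumℝ-cong λ j →
    let p = α i * β j ; x = h (i , j) in begin
    sumPaths n (λ ω → (p * ℙ ω) * f ((i , j) ∷ ω))
      ≈⟨ sumPaths-cong n (λ ω → ≃-trans (*-cong ≃-refl (R.reflexive (f≡h (i , j) ω))) (R.*-assoc p (ℙ ω) x)) ⟩
    sumPaths n (λ ω → p * (ℙ ω * x))
      ≈⟨ sumPaths-cong n (λ ω → ≃-trans (*-cong ≃-refl (R.*-comm (ℙ ω) x)) (≃-sym (R.*-assoc p x (ℙ ω)))) ⟩
    sumPaths n (λ ω → (p * x) * ℙ ω)
      ≈⟨ *-distribˡ-sumPaths n (p * x) ℙ ⟩
    (p * x) * sumPaths n ℙ
      ≈⟨ *-cong ≃-refl (sumPaths-ℙ n) ⟩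
    (p * x) * 1ℝ
      ≈⟨ R.*-identityʳ (p * x) ⟩
    p * x ∎
    where open SetoidReasoning R.setoid

  expectedPairCost : ℝ
  expectedPairCost = sumℝ λ i → sumℝ λ j → (α i * β j) * pairCost (i , j)

  expectedPairCost-nonNeg : 0ℝ ≼ expectedPairCost
  expectedPairCost-nonNeg = sumℝ-nonNeg λ i → sumℝ-nonNeg λ j →
    0≼*0≼ (<⇒≼ (positive i j)) (pairCost-nonNeg (i , j))

  pairCost≼c : ∀ π y n a ω → pairCost a ≼ c (Y π y (suc n) (a ∷ ω))
  pairCost≼c π y n a ω = pairCost≼ (balanced⇒sumOfPairs (proj₁ q) (proj₂ q)) a
    where
    q : 𝒬
    q = X (Y π y n ω) ⊟ π n (X (Y π y n ω))

  module _ (rule : DecisionRule) (matches : MatchesEverything rule) where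

    c-matchEverything : ∀ y n a ω → c (Y (stationary rule) y (suc n) (a ∷ ω)) ≡ pairCost a
    c-matchEverything y n a ω =
      cong (λ q → vecCost (q ⊕ eₐ a)) (matches (X (Y (stationary rule) y n ω)))

    -- A coupling: arrivals do not depend on the matchings, so one path drives both processes. At
    -- time 0 the costs coincide.
    c-mono : ∀ π y n ω → c (Y (stationary rule) y n ω) ≼ c (Y π y n ω)
    c-mono π y zero    []      = ≼-refl
    c-mono π y (suc n) (a ∷ ω) =
      ≼-trans (≃⇒≼ (R.reflexive (c-matchEverything y n a ω))) (pairCost≼c π y n a ω)

    module _ {θ : ℝ} (0≼θ : 0ℝ ≼ θ) where

      partialCost-mono : ∀ π y N → partialCost θ (stationary rule) y N ≼ partialCost θ π y N
      partialCost-mono π y N = sumℝ-mono {N} λ n →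
        *-monoˡ-≼ (0≼^ 0≼θ (toℕ n)) (𝔼-mono (toℕ n) (c-mono π y (toℕ n)))

      module _ (θ<1 : θ < 1ℝ) (y : 𝒴) where

        -- The discounted expected cost of all times from 1 on.
        futureCost : ∃[ t ] t ≃ θ * expectedPairCost + θ * t × 0ℝ ≼ t
        futureCost =
          let g , g≃ , 0≼g = geometric-sum θ<1
          in x * g ,
             ≃-trans (*-cong ≃-refl g≃)
               (pointwise⇒≃ {x * (1ℝ + θ * g)} {x + θ * (x * g)} λ n → lem (seq x n) (seq θ n) (seq g n)) ,
             0≼*0≼ (0≼*0≼ 0≼θ expectedPairCost-nonNeg) 0≼g
          where
          open +-*-Solver
          x : ℝ
          x = θ * expectedPairCost
          lem : ∀ x θ g → x ℚ.* (1ℚ ℚ.+ θ ℚ.* g) ≡ x ℚ.+ θ ℚ.* (x ℚ.* g)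
          lem = solve 3 (λ x θ g → x :* (con 1ℚ :+ θ :* g) := x :+ θ :* (x :* g)) refl

        t : ℝ
        t = proj₁ futureCost

        value : ℝ
        value = c y + t

        partialCost-matchEverything : ∀ N →
          partialCost θ (stationary rule) y (suc N) + θ ^ N * t ≃ value
        partialCost-matchEverything N = begin
          -- The two units are `θ ^ 0` and the probability of the empty path.
          (1ℝ * (1ℝ * c y) + sumℝ {N} S′) + θ ^ N * t
            ≈⟨ R.+-assoc (1ℝ * (1ℝ * c y)) (sumℝ {N} S′) (θ ^ N * t) ⟩
          1ℝ * (1ℝ * c y) + (sumℝ {N} S′ + θ ^ N * t)
            ≈⟨ +-cong (≃-trans (R.*-identityˡ (1ℝ * c y)) (R.*-identityˡ (c y)))
                      (+-cong (sumℝ-cong {N} S′≃S) ≃-refl) ⟩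
          c y + (sumℝ {N} S + θ ^ N * t)
            ≈⟨ +-cong ≃-refl (geometric-partialSum (proj₁ (proj₂ futureCost)) N) ⟩
          value ∎
          where
          open SetoidReasoning R.setoid
          S S′ : Fin N → ℝ
          S  n = θ ^ suc (toℕ n) * expectedPairCost
          S′ n = θ ^ suc (toℕ n) * 𝔼 (suc (toℕ n)) λ ω → c (Y (stationary rule) y (suc (toℕ n)) ω)
          S′≃S : ∀ n → S′ n ≃ S n
          S′≃S n = *-cong ≃-refl (𝔼-latest (toℕ n)
            (λ ω → c (Y (stationary rule) y (suc (toℕ n)) ω)) pairCost (c-matchEverything y (toℕ n)))

        value-isDiscountedCost : IsDiscountedCost θ (stationary rule) y value
        value-isDiscountedCost = converges {partialCost θ (stationary rule) y} {value} r
          (1 , λ { (suc N) _ → partialCost-matchEverything N })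
          (λ n → 0≼*0≼ (0≼^ 0≼θ (ℕ.pred n)) (proj₂ (proj₂ futureCost)))
          (λ η η>0 → let N , h = geometric-decay 0≼θ θ<1 t η η>0 in
            suc N , λ { (suc n) (ℕ.s≤s N≤n) → h n N≤n })
          where
          -- partialCost at suc N contains the times 0, …, N; the value of r at 0 is irrelevant.
          r : ℕ → ℝ
          r n = θ ^ ℕ.pred n * t

      matchEverything-optimal : θ < 1ℝ → IsOptimal θ (stationary rule)
      matchEverything-optimal θ<1 y =
        value θ<1 y , converges-to-value ,
        (λ w (π , π→w) → ≼⇒≤ {value θ<1 y} {w} (converges-mono {partialCost θ (stationary rule) y} {partialCost θ π y}
          (partialCost-mono π y) converges-to-value π→w)) ,
        -- The infimum is attained, so a lower bound is simply evaluated at this policy.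
        (λ l lower → lower (value θ<1 y) (stationary rule , converges-to-value))
        where
        converges-to-value : IsDiscountedCost θ (stationary rule) y (value θ<1 y)
        converges-to-value = value-isDiscountedCost θ<1 y

theorem3 : (G : BipartiteGraph) → IsComplete G →
    (A : ArrivalLaw G) → IsStable A →
    (C : LinearCost G) →
    let open DiscountedProblem A C in
    ∃ MatchesEverything ×
    (∀ rule → MatchesEverything rule →
    ∀ θ → 0ℝ ≤ θ → θ < 1ℝ → IsOptimal θ (stationary rule))
theorem3 G complete A _ C =
  SumsOfPairs.matchEverything G complete ,
  λ rule matches θ 0≤θ → CompleteGraph.matchEverything-optimal complete A C rule matches (≤⇒≼ 0≤θ)
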